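{- Let $n\ge3$ and $m=\lfloor n/2\rfloor$. The map $$P^{\mathrm{AI}}:\bigsqcup_{\lambda\in\mathrm{Par}_n}\mathrm{SST}_n(\lambda)\to\bigsqcup_{\rho\in\mathrm{Par}_m}\mathrm{SST}_n^{\mathrm{AI}}(\rho);\quad T\mapsto P^{\mathrm{AI}}(T)$$ is a morphism of $\mathrm{AI}$-crystals; that is, setting $P^{\mathrm{AI}}(0)=0$, one has $P^{\mathrm{AI}}(\widetilde B_iT)=\widetilde B_iP^{\mathrm{AI}}(T)$ and $\deg_i(P^{\mathrm{AI}}(T))=\deg_i(T)$ for all $T$ and all $i\in\{1,\dots,n-1\}$.
   Context: Tableaux and words. $\mathrm{Par}_l$ is the set of partitions of length $\ell(\lambda)\le l$. $\mathrm{SST}_n(\lambda)$ is the set of semistandard Young tableaux of shape $\lambda$ with entries in $\{1,\dots,n\}$; $d_j$ is the length of the $j$-th column of the diagram. The column reading $\mathrm{CR}(T)$ reads the columns left to right, each from bottom to top. $P(w)$ is the Robinson–Schensted $P$-symbol of a word $w$ (successive Schensted row insertion of its letters into the empty tableau). Operators. For $i\in\{1,\dots,n-1\}$ and a word $w$, keep only letters $i,i+1$ and successively delete adjacent pairs $(i+1),i$ (an $i+1$ immediately left of an $i$ among the remaining letters) until $i^{a}(i+1)^{b}$ is left; $\varphi_i(w)=a$, $\varepsilon_i(w)=b$; $\widetilde F_i w$ changes the rightmost undeleted $i$ into $i+1$ ($0$ if $a=0$), $\widetilde E_iw$ changes the leftmost undeleted $i+1$ into $i$ ($0$ if $b=0$).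 For $T\in\mathrm{SST}_n(\lambda)$, $\varphi_i,\varepsilon_i$ are those of $\mathrm{CR}(T)$, and $\widetilde E_iT,\widetilde F_iT$ are the tableaux of shape $\lambda$ (or $0$) with column readings $\widetilde E_i\mathrm{CR}(T),\widetilde F_i\mathrm{CR}(T)$. The $\mathrm{AI}$-crystal structure on $\mathrm{SST}_n(\lambda)$ is: $\deg_i(T)=\varepsilon_i(T)$, $\widetilde B_iT=\widetilde E_iT$ if $\varphi_i(T)$ is even; $\deg_i(T)=\varepsilon_i(T)+1$, $\widetilde B_iT=\widetilde F_iT$ if $\varphi_i(T)$ is odd. The map $K_1$. For a column $C$ with entry set $J\subset\{1,\dots,n\}$ (possibly empty), $K(C)$ is the column with entry set $\{1,\dots,n\}\setminus J$. For $T\in\mathrm{SST}_n(\lambda)$ with columns $C_1,C_2,\dots,C_{\lambda_1}$ (for $\lambda=\emptyset$ take $C_1$ to be the empty column), $K_1(T):=P(\mathrm{CR}(K(C_1))*\mathrm{CR}(C_2)*\cdots*\mathrm{CR}(C_{\lambda_1}))$, where $*$ is concatenation. $\mathrm{AI}$-tableaux. $T\in\mathrm{SST}_n(\lambda)$ (entries $t_{i,j}$) is an $\mathrm{AI}$-tableau if $d_1\le m$ and $t^c_{i,1}\le t_{i,2}$ for all $1\le i\le d_2$, where $t^c_{1,1}<\dots<t^c_{n-d_1,1}$ are the elements of $\{1,\dots,n\}\setminus\{t_{1,1},\dots,t_{d_1,1}\}$. $\mathrm{SST}_n^{\mathrm{AI}}(\lambda)$ is the set of $\mathrm{AI}$-tableaux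 of shape $\lambda$; it is stable under the $\widetilde B_i$ and carries the restricted structure. For every $T$ some $K_1^r(T)$, $r\ge0$, is an $\mathrm{AI}$-tableau, and $P^{\mathrm{AI}}(T):=K_1^r(T)$ with $r\ge0$ minimal with this property. -}

module Defs where

open import Data.Bool.Base using (if_then_else_)
open import Data.Empty using (⊥; ⊥-elim)
open import Data.Fin.Base using (Fin; zero; suc)
open import Data.List.Base
  using (List; []; _∷_; _++_; _[_]∷=_; concat; concatMap; drop; filter; foldl; foldr;
         applyUpTo; head; last; length; map; reverse; take)
open import Data.List.Membership.Propositional using (_∈_; _∉_)
open import Data.List.Membership.Propositional.Properties
  using (∈-++⁺ˡ; ∈-++⁺ʳ; ∈-++⁻; ∈-∃++; ∈-filter⁺; ∈-filter⁻; ∈-applyUpTo⁺; ∈-applyUpTo⁻)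
open import Data.List.Properties
  using (++-assoc; ++-identityʳ; length-++; length-map; length-reverse; length-applyUpTo;
         reverse-++; reverse-involutive; ∷-injectiveˡ; ∷-injectiveʳ; unfold-reverse; length-drop; length-take;
         take++drop≡id)
open import Data.List.Relation.Binary.Prefix.Heterogeneous as Prefix using (Prefix; []; _∷_)
open import Data.List.Relation.Binary.Prefix.Heterogeneous.Properties using (prefix?; length-mono)
open import Data.List.Relation.Binary.Sublist.Propositional using (_⊆_; []; _∷ʳ_; _∷_; minimum; ⊆-refl; ⊆-trans)
import Data.List.Relation.Binary.Sublist.Propositional.Properties as Sublistₚ
open import Data.List.Relation.Unary.All as All using (All; []; _∷_)
open import Data.List.Relation.Unary.Any using (here; there)
open import Data.List.Relation.Unary.Any.Properties using (reverse⁻)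
import Data.List.Relation.Unary.All.Properties as Allₚ
open import Data.List.Relation.Unary.Unique.Propositional using (Unique)
import Data.List.Relation.Unary.Unique.Propositional.Properties as Uniqueₚ
import Data.List.Relation.Unary.AllPairs as AllPairs
open import Data.List.Relation.Unary.Linked as Linked using (Linked; []; [-]; _∷_)
import Data.List.Relation.Unary.Linked.Properties as Linkedₚ
open import Data.Maybe.Base as Maybe using (Maybe; just; nothing; fromMaybe)
open import Data.Nat.Base
open import Data.Nat.Divisibility using (_∣?_)
open import Data.Nat.GeneralisedArithmetic using (iterate)
open import Data.Nat.Properties
open import Data.List.Membership.DecPropositional _≟_ using (_∈?_)
open import Data.Nat.Induction using (Acc; acc; <-wellFounded)
open import Data.Product.Base using (Σ-syntax; ∃-syntax; _×_; _,_; proj₁; proj₂)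
open import Data.Sum.Base using (_⊎_; inj₁; inj₂)
open import Function.Base using (flip; _∘_)
open import Level using (0ℓ)
open import Relation.Binary.Core using (Rel)
open import Relation.Binary.PropositionalEquality
open import Relation.Nullary using (¬_; Dec; does; yes; no; ¬?; _×-dec_)

Word : Set
Word = List ℕ

Rows : Set
Rows = List (List ℕ)

consRow : List ℕ → Rows → Rows
consRow []      cs       = cs
consRow (x ∷ r) []       = (x ∷ []) ∷ consRow r []
consRow (x ∷ r) (c ∷ cs) = (x ∷ c) ∷ consRow r cs

transpose : Rows → Rows
transpose = foldr consRow []

-- Rows are listed from top to bottom, columns from left to right with their
-- entries from top to bottom.
columns : Rows → Rows
columns = transpose

-- Indexed from 0; empty beyond the last column.
column : ℕ → Rows → List ℕ
column j T = fromMaybe [] (head (drop j (columns T)))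

reading : Rows → Word
reading = concatMap reverse

CR : Rows → Word
CR T = reading (columns T)

record Partition : Set where
  field
    parts      : List ℕ
    decreasing : Linked _≥_ parts
    positive   : All (0 <_) parts

open Partition public

Par : ℕ → Set
Par l = Σ[ μ ∈ Partition ] length (parts μ) ≤ l

-- s is no longer than r, and R a b holds for every entry b of s and the entry a
-- of r in the same position.  For rows, s lies below r; for columns, s lies to
-- the right of r.
Under : Rel ℕ 0ℓ → Rel (List ℕ) 0ℓ
Under R r s = Prefix (flip R) s r

record Semistandard (n : ℕ) (T : Rows) : Set where
  field
    bounds         : All (All (λ x → 1 ≤ x × x ≤ n)) T
    rows-weak      : All (Linked _≤_) T
    columns-strict : Linked (Under _<_) T

open Semistandard public

record SST (n : ℕ) (μ : Partition) : Set where
  field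
    rows         : Rows
    shape        : map length rows ≡ parts μ
    semistandard : Semistandard n rows

open SST public

SST⊔ : ℕ → Set
SST⊔ n = Σ[ μ ∈ Par n ] SST n (proj₁ μ)

-- The new row and the entry bumped out of it, if any.
rowInsert : ℕ → List ℕ → List ℕ × Maybe ℕ
rowInsert x []      = x ∷ [] , nothing
rowInsert x (y ∷ r) with x <? y
... | yes _ = x ∷ r , just y
... | no _  = y ∷ proj₁ (rowInsert x r) , proj₂ (rowInsert x r)

insert : ℕ → Rows → Rows
carry  : Maybe ℕ → Rows → Rows

insert x []       = (x ∷ []) ∷ []
insert x (r ∷ rs) = proj₁ (rowInsert x r) ∷ carry (proj₂ (rowInsert x r)) rs

carry nothing  rs = rs
carry (just y) rs = insert y rs

P : Word → Rows
P = foldl (flip insert) []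

-- The positions of the undeleted letters i and of the undeleted letters i+1.
-- The word is scanned from the right.  What is left of a suffix has the form
-- i^a (i+1)^b, so a letter i+1 put in front of it forms an adjacent pair with
-- the first undeleted i, if there is one.
prepend : {A : Set} → (i x : ℕ) → A → List A × List A → List A × List A
prepend i x k (as , bs) with x ≟ i | x ≟ suc i
prepend i x k (as     , bs) | yes _ | _     = k ∷ as , bs
prepend i x k ([]     , bs) | no _  | yes _ = [] , k ∷ bs
prepend i x k (a ∷ as , bs) | no _  | yes _ = as , bs
prepend i x k (as     , bs) | no _  | no _  = as , bs

undeleted : ℕ → (w : Word) → List (Fin (length w)) × List (Fin (length w))
undeleted i []      = [] , []
undeleted i (x ∷ w) =
  prepend i x zero (map suc (proj₁ (undeleted i w)) , map suc (proj₂ (undeleted i w)))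

φʷ εʷ : ℕ → Word → ℕ
φʷ i w = length (proj₁ (undeleted i w))
εʷ i w = length (proj₂ (undeleted i w))

F̃ʷ Ẽʷ : ℕ → Word → Maybe Word
F̃ʷ i w = Maybe.map (λ k → w [ k ]∷= suc i) (last (proj₁ (undeleted i w)))
Ẽʷ i w = Maybe.map (λ k → w [ k ]∷= i) (head (proj₂ (undeleted i w)))

last-map-suc : ∀ {m} (as : List (Fin m)) {k} → last (map suc as) ≡ just k →
               ∃[ j ] k ≡ suc j × last as ≡ just j
last-map-suc (a ∷ [])     refl = a , refl , refl
last-map-suc (a ∷ b ∷ as) e    = last-map-suc (b ∷ as) e

data Letter (i : ℕ) : ℕ → Set where
  low   : Letter i i
  high  : Letter i (suc i)
  other : ∀ {x} → x ≢ i → x ≢ suc i → Letter i x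

letter : ∀ i x → Letter i x
letter i x with x ≟ i | x ≟ suc i
... | yes refl | _        = low
... | no _     | yes refl = high
... | no p     | no q     = other p q

φ-low : ∀ i w → φʷ i (i ∷ w) ≡ suc (φʷ i w)
φ-low i w with i ≟ i | i ≟ suc i
... | yes _ | _ = cong suc (length-map suc (proj₁ (undeleted i w)))
... | no p  | _ = ⊥-elim (p refl)

ε-low : ∀ i w → εʷ i (i ∷ w) ≡ εʷ i w
ε-low i w with i ≟ i | i ≟ suc i
... | yes _ | _ = length-map suc (proj₂ (undeleted i w))
... | no p  | _ = ⊥-elim (p refl)

φ-high : ∀ i w → φʷ i (suc i ∷ w) ≡ pred (φʷ i w)
φ-high i w with suc i ≟ i | suc i ≟ suc i | proj₁ (undeleted i w)
... | yes p | _     | _      = ⊥-elim (1+n≢n p)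
... | no _  | no p  | _      = ⊥-elim (p refl)
... | no _  | yes _ | []     = refl
... | no _  | yes _ | a ∷ as = length-map suc as

ε-high₀ : ∀ i w → φʷ i w ≡ 0 → εʷ i (suc i ∷ w) ≡ suc (εʷ i w)
ε-high₀ i w e with suc i ≟ i | suc i ≟ suc i | proj₁ (undeleted i w)
... | yes p | _     | _      = ⊥-elim (1+n≢n p)
... | no _  | no p  | _      = ⊥-elim (p refl)
... | no _  | yes _ | []     = cong suc (length-map suc (proj₂ (undeleted i w)))

ε-high₊ : ∀ i w → φʷ i w ≢ 0 → εʷ i (suc i ∷ w) ≡ εʷ i w
ε-high₊ i w e with suc i ≟ i | suc i ≟ suc i | proj₁ (undeleted i w)
... | yes p | _     | _      = ⊥-elim (1+n≢n p)
... | no _  | no p  | _      = ⊥-elim (p refl)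
... | no _  | yes _ | []     = ⊥-elim (e refl)
... | no _  | yes _ | a ∷ as = length-map suc (proj₂ (undeleted i w))

φ-other : ∀ {i x} w → x ≢ i → x ≢ suc i → φʷ i (x ∷ w) ≡ φʷ i w
φ-other {i} {x} w p q with x ≟ i | x ≟ suc i
... | yes e | _     = ⊥-elim (p e)
... | no _  | yes e = ⊥-elim (q e)
... | no _  | no _  = length-map suc (proj₁ (undeleted i w))

ε-other : ∀ {i x} w → x ≢ i → x ≢ suc i → εʷ i (x ∷ w) ≡ εʷ i w
ε-other {i} {x} w p q with x ≟ i | x ≟ suc i
... | yes e | _     = ⊥-elim (p e)
... | no _  | yes e = ⊥-elim (q e)
... | no _  | no _  = length-map suc (proj₂ (undeleted i w))

ε-∷ : ∀ i x w → εʷ i (x ∷ w) ≡ 0 → εʷ i w ≡ 0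
ε-∷ i x w e with letter i x
... | low       = trans (sym (ε-low i w)) e
... | other p q = trans (sym (ε-other w p q)) e
... | high with φʷ i w in eq
...   | zero  = ⊥-elim (1+n≢0 (trans (sym (ε-high₀ i w eq)) e))
...   | suc _ = trans (sym (ε-high₊ i w (λ z → 1+n≢0 (trans (sym eq) z)))) e

-- An i+1 followed by no undeleted i is undeleted.
unpaired-high : ∀ i u v → εʷ i (u ++ suc i ∷ v) ≡ 0 → i ∈ v
unpaired-high i (x ∷ u) v e = unpaired-high i u v (ε-∷ i x (u ++ suc i ∷ v) e)
unpaired-high i []      v e with φʷ i v in eq
... | zero  = ⊥-elim (1+n≢0 (trans (sym (ε-high₀ i v eq)) e))
... | suc _ = occurs v (λ z → 1+n≢0 (trans (sym eq) z))
  where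
  occurs : ∀ v → φʷ i v ≢ 0 → i ∈ v
  occurs []      p = ⊥-elim (p refl)
  occurs (x ∷ v) p with letter i x
  ... | low       = here refl
  ... | high      = there (occurs v (λ z → p (trans (φ-high i v) (cong pred z))))
  ... | other q r = there (occurs v (λ z → p (trans (φ-other v q r) z)))

-- An i preceded by no i+1 is undeleted.
unpaired-low : ∀ i u v → φʷ i (u ++ i ∷ v) ≡ 0 → suc i ∈ u
unpaired-low i []      v e = ⊥-elim (1+n≢0 (trans (sym (φ-low i v)) e))
unpaired-low i (x ∷ u) v e with letter i x
... | low       = ⊥-elim (1+n≢0 (trans (sym (φ-low i (u ++ i ∷ v))) e))
... | high      = here refl
... | other p q = there (unpaired-low i u v (trans (sym (φ-other (u ++ i ∷ v) p q)) e))

record Split (i x y : ℕ) (w w' : Word) : Set where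
  constructor split
  field
    u v  : Word
    old  : w ≡ u ++ x ∷ v
    new  : w' ≡ u ++ y ∷ v
    φv≡0 : φʷ i v ≡ 0
    εu≡0 : εʷ i u ≡ 0


last-low : ∀ i w k → last (proj₁ (undeleted i (i ∷ w))) ≡ just k →
           (k ≡ zero × φʷ i w ≡ 0) ⊎
           (∃[ j ] k ≡ suc j × last (proj₁ (undeleted i w)) ≡ just j)
last-low i w k e with i ≟ i | i ≟ suc i | proj₁ (undeleted i w)
last-low i w k e    | no p  | _ | _      = ⊥-elim (p refl)
last-low i w k refl | yes _ | _ | []     = inj₁ (refl , refl)
last-low i w k e    | yes _ | _ | a ∷ as = inj₂ (last-map-suc (a ∷ as) e)

last-high : ∀ i w k → last (proj₁ (undeleted i (suc i ∷ w))) ≡ just k →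
            2 ≤ φʷ i w × ∃[ j ] k ≡ suc j × last (proj₁ (undeleted i w)) ≡ just j
last-high i w k e with suc i ≟ i | suc i ≟ suc i | proj₁ (undeleted i w)
... | yes p | _     | _          = ⊥-elim (1+n≢n p)
... | no _  | no p  | _          = ⊥-elim (p refl)
... | no _  | yes _ | a ∷ b ∷ as = s≤s (s≤s z≤n) , last-map-suc (b ∷ as) e

last-other : ∀ {i x} w k → x ≢ i → x ≢ suc i →
             last (proj₁ (undeleted i (x ∷ w))) ≡ just k →
             ∃[ j ] k ≡ suc j × last (proj₁ (undeleted i w)) ≡ just j
last-other {i} {x} w k p q e with x ≟ i | x ≟ suc i
... | yes r | _     = ⊥-elim (p r)
... | no _  | yes r = ⊥-elim (q r)
... | no _  | no _  = last-map-suc (proj₁ (undeleted i w)) e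

head-map-suc : ∀ {m} (as : List (Fin m)) {k} → head (map suc as) ≡ just k →
               ∃[ j ] k ≡ suc j × head as ≡ just j
head-map-suc (a ∷ as) refl = a , refl , refl

head-low : ∀ i w k → head (proj₂ (undeleted i (i ∷ w))) ≡ just k →
           ∃[ j ] k ≡ suc j × head (proj₂ (undeleted i w)) ≡ just j
head-low i w k e with i ≟ i | i ≟ suc i
... | no p  | _ = ⊥-elim (p refl)
... | yes _ | _ = head-map-suc (proj₂ (undeleted i w)) e

head-high : ∀ i w k → head (proj₂ (undeleted i (suc i ∷ w))) ≡ just k →
            (k ≡ zero × φʷ i w ≡ 0) ⊎
            (φʷ i w ≢ 0 × ∃[ j ] k ≡ suc j × head (proj₂ (undeleted i w)) ≡ just j)
head-high i w k e with suc i ≟ i | suc i ≟ suc i | proj₁ (undeleted i w)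
head-high i w k e    | yes p | _     | _      = ⊥-elim (1+n≢n p)
head-high i w k e    | no _  | no p  | _      = ⊥-elim (p refl)
head-high i w k refl | no _  | yes _ | []     = inj₁ (refl , refl)
head-high i w k e    | no _  | yes _ | a ∷ as = inj₂ ((λ ()) , head-map-suc (proj₂ (undeleted i w)) e)

head-other : ∀ {i x} w k → x ≢ i → x ≢ suc i →
             head (proj₂ (undeleted i (x ∷ w))) ≡ just k →
             ∃[ j ] k ≡ suc j × head (proj₂ (undeleted i w)) ≡ just j
head-other {i} {x} w k p q e with x ≟ i | x ≟ suc i
... | yes r | _     = ⊥-elim (p r)
... | no _  | yes r = ⊥-elim (q r)
... | no _  | no _  = head-map-suc (proj₂ (undeleted i w)) e

F-split : ∀ i w k → last (proj₁ (undeleted i w)) ≡ just k →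
          Σ[ s ∈ Split i i (suc i) w (w [ k ]∷= suc i) ] φʷ i w ≡ suc (φʷ i (Split.u s))
F-split i (x ∷ w) k e with letter i x
F-split i (_ ∷ w) k e | low with last-low i w k e
... | inj₁ (refl , z) = split [] w refl refl z refl , trans (φ-low i w) (cong suc z)
... | inj₂ (j , refl , e') with F-split i w j e'
...   | split u v o n z y , t =
  split (i ∷ u) v (cong (i ∷_) o) (cong (i ∷_) n) z (trans (ε-low i u) y) ,
  trans (φ-low i w) (cong suc (trans t (sym (φ-low i u))))
F-split i (_ ∷ w) k e | high with last-high i w k e
... | l , j , refl , e' with F-split i w j e'
...   | split u v o n z y , t =
  split (suc i ∷ u) v (cong (suc i ∷_) o) (cong (suc i ∷_) n) z (trans (ε-high₊ i u nz) y) ,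
  trans (φ-high i w) (trans (cong pred t) (trans (unpred nz) (cong suc (sym (φ-high i u)))))
  where
  nz : φʷ i u ≢ 0
  nz e = 1+n≰n (subst (2 ≤_) (trans t (cong suc e)) l)
  unpred : ∀ {m} → m ≢ 0 → m ≡ suc (pred m)
  unpred {zero}  p = ⊥-elim (p refl)
  unpred {suc m} p = refl
F-split i (_ ∷ w) k e | other p q with last-other w k p q e
... | j , refl , e' with F-split i w j e'
...   | split u v o n z y , t =
  split (_ ∷ u) v (cong (_ ∷_) o) (cong (_ ∷_) n) z (trans (ε-other u p q) y) ,
  trans (φ-other w p q) (trans t (cong suc (sym (φ-other u p q))))

E-split : ∀ i w k → head (proj₂ (undeleted i w)) ≡ just k →
          Σ[ s ∈ Split i (suc i) i w (w [ k ]∷= i) ] φʷ i w ≡ φʷ i (Split.u s)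
E-split i (x ∷ w) k e with letter i x
E-split i (_ ∷ w) k e | low with head-low i w k e
... | j , refl , e' with E-split i w j e'
...   | split u v o n z y , t =
  split (i ∷ u) v (cong (i ∷_) o) (cong (i ∷_) n) z (trans (ε-low i u) y) ,
  trans (φ-low i w) (trans (cong suc t) (sym (φ-low i u)))
E-split i (_ ∷ w) k e | high with head-high i w k e
... | inj₁ (refl , z) = split [] w refl refl z refl , trans (φ-high i w) (cong pred z)
... | inj₂ (nz , j , refl , e') with E-split i w j e'
...   | split u v o n z y , t =
  split (suc i ∷ u) v (cong (suc i ∷_) o) (cong (suc i ∷_) n) z
    (trans (ε-high₊ i u (λ e → nz (trans t e))) y) ,
  trans (φ-high i w) (trans (cong pred t) (sym (φ-high i u)))
E-split i (_ ∷ w) k e | other p q with head-other w k p q e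
... | j , refl , e' with E-split i w j e'
...   | split u v o n z y , t =
  split (_ ∷ u) v (cong (_ ∷_) o) (cong (_ ∷_) n) z (trans (ε-other u p q) y) ,
  trans (φ-other w p q) (trans t (sym (φ-other u p q)))

transpose-consRow : ∀ {P : List ℕ → ℕ → Set} r {cs} → 0 < length r → Prefix P cs r →
                    transpose (consRow r cs) ≡ r ∷ transpose cs
transpose-consRow (x ∷ [])    p []        = refl
transpose-consRow (x ∷ [])    p (_ ∷ [])  = refl
transpose-consRow (x ∷ y ∷ r) p []        =
  cong (consRow (x ∷ [])) (transpose-consRow (y ∷ r) (s≤s z≤n) ([] {R = λ (_ : List ℕ) _ → ⊥}))
transpose-consRow (x ∷ y ∷ r) p (_∷_ {a = c} _ l) =
  cong (consRow (x ∷ c)) (transpose-consRow (y ∷ r) (s≤s z≤n) l)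

consRow-fits : ∀ {V : Rel ℕ 0ℓ} {r s cs} → Under V r s →
               Prefix (λ c x → Linked V (x ∷ c)) cs s →
               Prefix (λ c x → Linked V (x ∷ c)) (consRow s cs) r
consRow-fits []      []      = []
consRow-fits (v ∷ l) []      = (v ∷ [-]) ∷ consRow-fits l []
consRow-fits (v ∷ l) (p ∷ q) = (v ∷ p) ∷ consRow-fits l q

transpose-fits : ∀ {V : Rel ℕ 0ℓ} {r rs} → Linked (Under V) (r ∷ rs) →
                 Prefix (λ c x → Linked V (x ∷ c)) (transpose rs) r
transpose-fits [-]     = []
transpose-fits (p ∷ l) = consRow-fits p (transpose-fits l)

transpose-involutive : ∀ {V : Rel ℕ 0ℓ} {rs} → All (λ r → 0 < length r) rs →
                       Linked (Under V) rs → transpose (transpose rs) ≡ rs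
transpose-involutive []       _ = refl
transpose-involutive {rs = r ∷ _} (p ∷ ps) l =
  trans (transpose-consRow r p (transpose-fits l))
        (cong (r ∷_) (transpose-involutive ps (Linked.tail l)))

consRow-linked : ∀ {H V : Rel ℕ 0ℓ} {r cs} → Linked H r → Linked (Under H) cs →
                 Prefix (λ c x → Linked V (x ∷ c)) cs r →
                 All (Linked V) (consRow r cs) × Linked (Under H) (consRow r cs)
consRow-linked []      _       []      = [] , []
consRow-linked [-]     _       []      = ([-] ∷ []) , [-]
consRow-linked [-]     _       (p ∷ []) = (p ∷ []) , [-]
consRow-linked (h ∷ r) _       []      with consRow-linked r [] []
... | ps , l = ([-] ∷ ps) , ((h ∷ []) ∷ l)
consRow-linked (h ∷ r) _       (p ∷ []) with consRow-linked r [] []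
... | ps , l = (p ∷ ps) , ((h ∷ []) ∷ l)
consRow-linked (h ∷ r) (u ∷ k) (p ∷ q ∷ qs) with consRow-linked r k (q ∷ qs)
... | ps , l = (p ∷ ps) , ((h ∷ u) ∷ l)

transpose-linked : ∀ {H V : Rel ℕ 0ℓ} {rs} → All (Linked H) rs → Linked (Under V) rs →
                   All (Linked V) (transpose rs) × Linked (Under H) (transpose rs)
transpose-linked []       _ = [] , []
transpose-linked (p ∷ ps) l =
  consRow-linked p (proj₂ (transpose-linked ps (Linked.tail l))) (transpose-fits l)

consRow-All : ∀ {Q : ℕ → Set} {r cs} → All Q r → All (All Q) cs → All (All Q) (consRow r cs)
consRow-All []       qs       = qs
consRow-All (p ∷ ps) []       = (p ∷ []) ∷ consRow-All ps []
consRow-All (p ∷ ps) (q ∷ qs) = (p ∷ q) ∷ consRow-All ps qs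

transpose-All : ∀ {Q : ℕ → Set} {rs} → All (All Q) rs → All (All Q) (transpose rs)
transpose-All []       = []
transpose-All (p ∷ ps) = consRow-All p (transpose-All ps)

consRow-nonempty : ∀ r {cs} → All (λ c → 0 < length c) cs → All (λ c → 0 < length c) (consRow r cs)
consRow-nonempty []      ps       = ps
consRow-nonempty (x ∷ r) []       = s≤s z≤n ∷ consRow-nonempty r []
consRow-nonempty (x ∷ r) (p ∷ ps) = s≤s z≤n ∷ consRow-nonempty r ps

transpose-nonempty : ∀ rs → All (λ c → 0 < length c) (transpose rs)
transpose-nonempty []       = []
transpose-nonempty (r ∷ rs) = consRow-nonempty r (transpose-nonempty rs)

consRow-lengths : ∀ r s {cs ds} → length r ≡ length s → map length cs ≡ map length ds →
                  map length (consRow r cs) ≡ map length (consRow s ds)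
consRow-lengths []      []      e f = f
consRow-lengths (x ∷ r) (y ∷ s) {[]}     {[]}     e f =
  cong (1 ∷_) (consRow-lengths r s (suc-injective e) refl)
consRow-lengths (x ∷ r) (y ∷ s) {c ∷ cs} {d ∷ ds} e f =
  cong₂ _∷_ (cong suc (∷-injectiveˡ f)) (consRow-lengths r s (suc-injective e) (∷-injectiveʳ f))

transpose-lengths : ∀ rs ss → map length rs ≡ map length ss →
                    map length (transpose rs) ≡ map length (transpose ss)
transpose-lengths []       []       e = refl
transpose-lengths (r ∷ rs) (s ∷ ss) e =
  consRow-lengths r s (∷-injectiveˡ e) (transpose-lengths rs ss (∷-injectiveʳ e))

-- Only the lengths of the given columns matter.
refill : Rows → Word → Rows
refill []       w = []
refill (c ∷ cs) w = reverse (take (length c) w) ∷ refill cs (drop (length c) w)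

-- The filling of the diagram of T with the given column reading.
withReading : Rows → Word → Rows
withReading T w = transpose (refill (columns T) w)

take-++ : ∀ {m} (xs : Word) {ys} → length xs ≡ m → take m (xs ++ ys) ≡ xs
take-++ []       refl = refl
take-++ (x ∷ xs) refl = cong (x ∷_) (take-++ xs refl)

drop-++ : ∀ {m} (xs : Word) {ys} → length xs ≡ m → drop m (xs ++ ys) ≡ ys
drop-++ []       refl = refl
drop-++ (x ∷ xs) refl = drop-++ xs refl

refill-++ : ∀ c cs z {w} → length z ≡ length c →
            refill (c ∷ cs) (z ++ w) ≡ reverse z ∷ refill cs w
refill-++ c cs z e =
  cong₂ _∷_ (cong reverse (take-++ z e)) (cong (refill cs) (drop-++ z e))

refill-reading : ∀ cs → refill cs (reading cs) ≡ cs
refill-reading []       = refl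
refill-reading (c ∷ cs) =
  trans (refill-++ c cs (reverse c) (length-reverse c))
        (cong₂ _∷_ (reverse-involutive c) (refill-reading cs))

split-++ : ∀ (p q u : Word) {x v} → p ++ q ≡ u ++ x ∷ v →
           (∃[ v' ] p ≡ u ++ x ∷ v' × v ≡ v' ++ q) ⊎ (∃[ u' ] u ≡ p ++ u' × q ≡ u' ++ x ∷ v)
split-++ []      q u       e    = inj₂ (u , refl , e)
split-++ (y ∷ p) q []      refl = inj₁ (p , refl , refl)
split-++ (y ∷ p) q (z ∷ u) e with ∷-injectiveˡ e | split-++ p q u (∷-injectiveʳ e)
... | refl | inj₁ (v' , f , g) = inj₁ (v' , cong (y ∷_) f , g)
... | refl | inj₂ (u' , f , g) = inj₂ (u' , cong (y ∷_) f , g)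

record Cell (x y : ℕ) (u v : Word) (cs : Rows) : Set where
  field
    before after : Rows
    above below  : List ℕ
    old-columns  : cs ≡ before ++ (above ++ x ∷ below) ∷ after
    new-columns  : refill cs (u ++ y ∷ v) ≡ before ++ (above ++ y ∷ below) ∷ after
    u≡           : u ≡ reading before ++ reverse below
    v≡           : v ≡ reverse above ++ reading after

reverse-mid : ∀ (u : Word) x v → reverse (u ++ x ∷ v) ≡ reverse v ++ x ∷ reverse u
reverse-mid u x v = begin
  reverse (u ++ x ∷ v)               ≡⟨ reverse-++ u (x ∷ v) ⟩
  reverse (x ∷ v) ++ reverse u       ≡⟨ cong (_++ reverse u) (unfold-reverse x v) ⟩
  (reverse v ++ x ∷ []) ++ reverse u ≡⟨ ++-assoc (reverse v) (x ∷ []) (reverse u) ⟩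
  reverse v ++ x ∷ reverse u         ∎
  where open ≡-Reasoning

locate : ∀ x y u v cs → reading cs ≡ u ++ x ∷ v → Cell x y u v cs
locate x y []      v [] ()
locate x y (_ ∷ _) v [] ()
locate x y u v (c ∷ cs) e with split-++ (reverse c) (reading cs) u e
... | inj₁ (v' , f , refl) = record
  { before      = []
  ; after       = cs
  ; above       = reverse v'
  ; below       = reverse u
  ; old-columns = cong (_∷ cs) (trans (sym (reverse-involutive c))
                    (trans (cong reverse f) (reverse-mid u x v')))
  ; new-columns = begin
      refill (c ∷ cs) (u ++ y ∷ v' ++ reading cs)
        ≡⟨ cong (refill (c ∷ cs)) (sym (++-assoc u (y ∷ v') (reading cs))) ⟩
      refill (c ∷ cs) ((u ++ y ∷ v') ++ reading cs)
        ≡⟨ refill-++ c cs (u ++ y ∷ v') len ⟩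
      reverse (u ++ y ∷ v') ∷ refill cs (reading cs)
        ≡⟨ cong₂ _∷_ (reverse-mid u y v') (refill-reading cs) ⟩
      (reverse v' ++ y ∷ reverse u) ∷ cs ∎
  ; u≡          = sym (reverse-involutive u)
  ; v≡          = cong (_++ reading cs) (sym (reverse-involutive v'))
  }
  where
  open ≡-Reasoning
  len : length (u ++ y ∷ v') ≡ length c
  len = begin
    length (u ++ y ∷ v') ≡⟨ length-++ u ⟩
    length u + suc (length v') ≡⟨ sym (length-++ u) ⟩
    length (u ++ x ∷ v') ≡⟨ cong length (sym f) ⟩
    length (reverse c) ≡⟨ length-reverse c ⟩
    length c ∎
... | inj₂ (u' , refl , g) = record
  { before      = c ∷ before
  ; after       = after
  ; above       = above
  ; below       = below
  ; old-columns = cong (c ∷_) old-columns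
  ; new-columns = begin
      refill (c ∷ cs) ((reverse c ++ u') ++ y ∷ v)
        ≡⟨ cong (refill (c ∷ cs)) (++-assoc (reverse c) u' (y ∷ v)) ⟩
      refill (c ∷ cs) (reverse c ++ u' ++ y ∷ v)
        ≡⟨ refill-++ c cs (reverse c) (length-reverse c) ⟩
      reverse (reverse c) ∷ refill cs (u' ++ y ∷ v)
        ≡⟨ cong₂ _∷_ (reverse-involutive c) new-columns ⟩
      c ∷ before ++ (above ++ y ∷ below) ∷ after ∎
  ; u≡          = trans (cong (reverse c ++_) u≡)
                    (sym (++-assoc (reverse c) (reading before) (reverse below)))
  ; v≡          = v≡
  }
  where
  open ≡-Reasoning
  open Cell (locate x y u' v cs g)

Bounded : ℕ → ℕ → Set
Bounded n x = 1 ≤ x × x ≤ n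

record GoodColumns (n : ℕ) (cs : Rows) : Set where
  field
    bounded : All (All (Bounded n)) cs
    strict  : All (Linked _<_) cs
    weak    : Linked (Under _≤_) cs

good-columns : ∀ {n T} → Semistandard n T → GoodColumns n (columns T)
good-columns {n} {T} s = record
  { bounded = transpose-All (bounds s)
  ; strict  = proj₁ (transpose-linked (rows-weak s) (columns-strict s))
  ; weak    = proj₂ (transpose-linked (rows-weak s) (columns-strict s))
  }

good-rows : ∀ {n cs} → GoodColumns n cs → Semistandard n (transpose cs)
good-rows g = record
  { bounds         = transpose-All bounded
  ; rows-weak      = proj₁ (transpose-linked strict weak)
  ; columns-strict = proj₂ (transpose-linked strict weak)
  }
  where open GoodColumns g

linked-< : ∀ {x b z} → Linked _<_ (x ∷ b) → z ∈ b → x < z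
linked-< (p ∷ _) (here refl) = p
linked-< (p ∷ l) (there q)   = <-trans p (linked-< l q)

below-> : ∀ a {x b z} → Linked _<_ (a ++ x ∷ b) → z ∈ b → x < z
below-> []      l q = linked-< l q
below-> (_ ∷ a) l q = below-> a (Linked.tail l) q

above-< : ∀ a {x b z} → Linked _<_ (a ++ x ∷ b) → z ∈ a → z < x
above-< (_ ∷ a) l (here refl) = linked-< l (∈-++⁺ʳ a (here refl))
above-< (_ ∷ a) l (there q)   = above-< a (Linked.tail l) q

raise-column : ∀ a {i b} → Linked _<_ (a ++ i ∷ b) → suc i ∉ b → Linked _<_ (a ++ suc i ∷ b)
raise-column []          [-]     q = [-]
raise-column []          (p ∷ l) q = ≤∧≢⇒< p (λ { refl → q (here refl) }) ∷ l
raise-column (_ ∷ [])    (p ∷ l) q = m<n⇒m<1+n p ∷ raise-column [] l q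
raise-column (_ ∷ y ∷ a) (p ∷ l) q = p ∷ raise-column (y ∷ a) l q

lower-column : ∀ a {i b} → Linked _<_ (a ++ suc i ∷ b) → i ∉ a → Linked _<_ (a ++ i ∷ b)
lower-column []          [-]     q = [-]
lower-column []          (p ∷ l) q = <-trans (n<1+n _) p ∷ l
lower-column (_ ∷ [])    (p ∷ l) q =
  ≤∧≢⇒< (s≤s⁻¹ p) (λ { refl → q (here refl) }) ∷ lower-column [] l (λ ())
lower-column (_ ∷ y ∷ a) (p ∷ l) q = p ∷ lower-column (y ∷ a) l (q ∘ there)

-- Replacing an entry of the left or of the right column of an adjacent pair.
change-left : ∀ a {x y b d} → Under _≤_ (a ++ x ∷ b) d →
              (∀ a' z b' → d ≡ a' ++ z ∷ b' → length a ≡ length a' → x ≤ z → y ≤ z) →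
              Under _≤_ (a ++ y ∷ b) d
change-left []      []      f = []
change-left []      (p ∷ l) f = f [] _ _ refl refl p ∷ l
change-left (_ ∷ a) []      f = []
change-left (_ ∷ a) (p ∷ l) f =
  p ∷ change-left a l (λ a' z b' e k → f (_ ∷ a') z b' (cong (_ ∷_) e) (cong suc k))

change-right : ∀ a {x y b c} → Under _≤_ c (a ++ x ∷ b) →
               (∀ a' z b' → c ≡ a' ++ z ∷ b' → length a ≡ length a' → z ≤ x → z ≤ y) →
               Under _≤_ c (a ++ y ∷ b)
change-right []      (p ∷ l) f = f [] _ _ refl refl p ∷ l
change-right (_ ∷ a) (p ∷ l) f =
  p ∷ change-right a l (λ a' z b' e k → f (_ ∷ a') z b' (cong (_ ∷_) e) (cong suc k))

below-≤ : ∀ a a' {x y b b' z} → Under _≤_ (a ++ x ∷ b) (a' ++ y ∷ b') →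
          length a ≡ length a' → z ∈ b' → ∃[ t ] t ∈ b × t ≤ z
below-≤ (_ ∷ a) (_ ∷ a') (_ ∷ l) e q = below-≤ a a' l (suc-injective e) q
below-≤ []      []       (_ ∷ l) e q = go l q
  where
  go : ∀ {b b' z} → Under _≤_ b b' → z ∈ b' → ∃[ t ] t ∈ b × t ≤ z
  go (p ∷ l) (here refl) = _ , here refl , p
  go (p ∷ l) (there q) with go l q
  ... | t , m , r = t , there m , r

above-≥ : ∀ a a' {x y b b' z} → Under _≤_ (a' ++ y ∷ b') (a ++ x ∷ b) →
          length a ≡ length a' → z ∈ a' → ∃[ t ] t ∈ a × z ≤ t
above-≥ (_ ∷ a) (_ ∷ a') (p ∷ l) e (here refl) = _ , here refl , p
above-≥ (_ ∷ a) (_ ∷ a') (p ∷ l) e (there q) with above-≥ a a' l (suc-injective e) q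
... | t , m , r = t , there m , r

linked-replace : ∀ {R : Rel (List ℕ) 0ℓ} L {c c' rs} → Linked R (L ++ c ∷ rs) →
                 (∀ L' b → L ≡ L' ++ b ∷ [] → R b c → R b c') →
                 (∀ d rs' → rs ≡ d ∷ rs' → R c d → R c' d) → Linked R (L ++ c' ∷ rs)
linked-replace []          [-]     f g = [-]
linked-replace []          (p ∷ l) f g = g _ _ refl p ∷ l
linked-replace (b ∷ [])    (p ∷ l) f g =
  f [] b refl p ∷ linked-replace [] l (λ { [] _ () ; (_ ∷ _) _ () }) g
linked-replace (a ∷ b ∷ L) (p ∷ l) f g =
  p ∷ linked-replace (b ∷ L) l (λ L' d e → f (a ∷ L') d (cong (a ∷_) e)) g

all-replace : ∀ {A : Set} {Q : A → Set} xs {x y ys} → All Q (xs ++ x ∷ ys) → Q y →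
              All Q (xs ++ y ∷ ys)
all-replace []       (_ ∷ ps) q = q ∷ ps
all-replace (_ ∷ xs) (p ∷ ps) q = p ∷ all-replace xs ps q

all-middle : ∀ {A : Set} {Q : A → Set} xs {x ys} → All Q (xs ++ x ∷ ys) → Q x
all-middle []       (p ∷ _)  = p
all-middle (_ ∷ xs) (_ ∷ ps) = all-middle xs ps

reading-++ : ∀ cs ds → reading (cs ++ ds) ≡ reading cs ++ reading ds
reading-++ []       ds = refl
reading-++ (c ∷ cs) ds =
  trans (cong (reverse c ++_) (reading-++ cs ds)) (sym (++-assoc (reverse c) (reading cs) _))

F-good : ∀ {n i cs w'} → i < n → GoodColumns n cs → Split i i (suc i) (reading cs) w' →
         GoodColumns n (refill cs w')
F-good {n} {i} {cs} {w'} i<n g (split u v o refl φv εu) = subst (GoodColumns n) (sym new-columns) record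
  { bounded = all-replace before bounded'
                (all-replace above (all-middle before bounded') (s≤s z≤n , i<n))
  ; strict  = all-replace before strict' (raise-column above C-strict no-high)
  ; weak    = linked-replace before weak'
                (λ _ _ _ p → change-right above p (λ _ _ _ _ _ q → m≤n⇒m≤1+n q))
                right
  }
  where
  open Cell (locate i (suc i) u v cs o)
  open GoodColumns (subst (GoodColumns n) old-columns g)
    renaming (bounded to bounded'; strict to strict'; weak to weak')
  C-strict : Linked _<_ (above ++ i ∷ below)
  C-strict = all-middle before strict'
  no-high : suc i ∉ below
  no-high m with p , q , e ← ∈-∃++ m =
    <-irrefl refl (below-> above C-strict
      (subst (i ∈_) (sym e) (∈-++⁺ˡ {xs = p} (reverse⁻ {xs = p} (unpaired-high i (reading before ++ reverse q) (reverse p)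
        (trans (cong (εʷ i) (sym (begin
          u ≡⟨ u≡ ⟩
          reading before ++ reverse below ≡⟨ cong (λ z → reading before ++ reverse z) e ⟩
          reading before ++ reverse (p ++ suc i ∷ q)
            ≡⟨ cong (reading before ++_) (reverse-mid p (suc i) q) ⟩
          reading before ++ reverse q ++ suc i ∷ reverse p
            ≡⟨ sym (++-assoc (reading before) (reverse q) _) ⟩
          (reading before ++ reverse q) ++ suc i ∷ reverse p ∎))) εu))))))
    where open ≡-Reasoning
  right : ∀ d rs → after ≡ d ∷ rs → Under _≤_ (above ++ i ∷ below) d →
          Under _≤_ (above ++ suc i ∷ below) d
  right d rs e p = change-left above p λ a' z b' f k q → ≤∧≢⇒< q λ { refl → absurd a' b' f k }
    where
    absurd : ∀ a' b' → d ≡ a' ++ i ∷ b' → length above ≡ length a' → ⊥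
    absurd a' b' f k = neither (∈-++⁻ (reverse above) (unpaired-low i (reverse above ++ reverse b')
                                (reverse a' ++ reading rs) (trans (cong (φʷ i) (sym eq)) φv)))
      where
      open ≡-Reasoning
      eq : v ≡ (reverse above ++ reverse b') ++ i ∷ reverse a' ++ reading rs
      eq = begin
        v ≡⟨ v≡ ⟩
        reverse above ++ reading after ≡⟨ cong (λ z → reverse above ++ reading z) e ⟩
        reverse above ++ reverse d ++ reading rs
          ≡⟨ cong (λ z → reverse above ++ reverse z ++ reading rs) f ⟩
        reverse above ++ reverse (a' ++ i ∷ b') ++ reading rs
          ≡⟨ cong (λ z → reverse above ++ z ++ reading rs) (reverse-mid a' i b') ⟩
        reverse above ++ (reverse b' ++ i ∷ reverse a') ++ reading rs
          ≡⟨ cong (reverse above ++_) (++-assoc (reverse b') (i ∷ reverse a') (reading rs)) ⟩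
        reverse above ++ reverse b' ++ i ∷ reverse a' ++ reading rs
          ≡⟨ sym (++-assoc (reverse above) (reverse b') _) ⟩
        (reverse above ++ reverse b') ++ i ∷ reverse a' ++ reading rs ∎
      neither : suc i ∈ reverse above ⊎ suc i ∈ reverse b' → ⊥
      neither (inj₁ m) = <-asym (above-< above C-strict (reverse⁻ m)) (n<1+n i)
      neither (inj₂ m) with below-≤ above a' (subst (Under _≤_ _) f p) k (reverse⁻ m)
      ... | t , t∈ , t≤ =
        no-high (subst (_∈ below) (≤-antisym t≤ (below-> above C-strict t∈)) t∈)

E-good : ∀ {n i cs w'} → 1 ≤ i → i < n → GoodColumns n cs → Split i (suc i) i (reading cs) w' →
         GoodColumns n (refill cs w')
E-good {n} {i} {cs} {w'} 1≤i i<n g (split u v o refl φv εu) =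
  subst (GoodColumns n) (sym new-columns) record
  { bounded = all-replace before bounded'
                (all-replace above (all-middle before bounded') (1≤i , <⇒≤ i<n))
  ; strict  = all-replace before strict' (lower-column above C-strict no-low)
  ; weak    = linked-replace before weak' left
                (λ _ _ _ p → change-left above p (λ _ _ _ _ _ q → <⇒≤ q))
  }
  where
  open Cell (locate (suc i) i u v cs o)
  open GoodColumns (subst (GoodColumns n) old-columns g)
    renaming (bounded to bounded'; strict to strict'; weak to weak')
  C-strict : Linked _<_ (above ++ suc i ∷ below)
  C-strict = all-middle before strict'
  no-low : i ∉ above
  no-low m with p , q , e ← ∈-∃++ m =
    <-irrefl refl (above-< above C-strict
      (subst (suc i ∈_) (sym e) (∈-++⁺ʳ p (there (reverse⁻ (unpaired-low i (reverse q)
        (reverse p ++ reading after)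
        (trans (cong (φʷ i) (sym (begin
          v ≡⟨ v≡ ⟩
          reverse above ++ reading after ≡⟨ cong (λ z → reverse z ++ reading after) e ⟩
          reverse (p ++ i ∷ q) ++ reading after
            ≡⟨ cong (_++ reading after) (reverse-mid p i q) ⟩
          (reverse q ++ i ∷ reverse p) ++ reading after
            ≡⟨ ++-assoc (reverse q) (i ∷ reverse p) (reading after) ⟩
          reverse q ++ i ∷ reverse p ++ reading after ∎))) φv)))))))
    where open ≡-Reasoning
  left : ∀ L b → before ≡ L ++ b ∷ [] → Under _≤_ b (above ++ suc i ∷ below) →
         Under _≤_ b (above ++ i ∷ below)
  left L b e p = change-right above p λ a' z b' f k q → s≤s⁻¹ (≤∧≢⇒< q λ { refl → absurd a' b' f k })
    where
    absurd : ∀ a' b' → b ≡ a' ++ suc i ∷ b' → length above ≡ length a' → ⊥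
    absurd a' b' f k = neither (∈-++⁻ (reverse a') (unpaired-high i (reading L ++ reverse b')
                                (reverse a' ++ reverse below) (trans (cong (εʷ i) (sym eq)) εu)))
      where
      open ≡-Reasoning
      eq : u ≡ (reading L ++ reverse b') ++ suc i ∷ reverse a' ++ reverse below
      eq = begin
        u ≡⟨ u≡ ⟩
        reading before ++ reverse below ≡⟨ cong (λ z → reading z ++ reverse below) e ⟩
        reading (L ++ b ∷ []) ++ reverse below ≡⟨ cong (_++ reverse below) (reading-++ L (b ∷ [])) ⟩
        (reading L ++ reverse b ++ []) ++ reverse below
          ≡⟨ cong (λ z → (reading L ++ z) ++ reverse below) (++-identityʳ (reverse b)) ⟩
        (reading L ++ reverse b) ++ reverse below
          ≡⟨ cong (λ z → (reading L ++ reverse z) ++ reverse below) f ⟩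
        (reading L ++ reverse (a' ++ suc i ∷ b')) ++ reverse below
          ≡⟨ cong (λ z → (reading L ++ z) ++ reverse below) (reverse-mid a' (suc i) b') ⟩
        (reading L ++ reverse b' ++ suc i ∷ reverse a') ++ reverse below
          ≡⟨ cong (_++ reverse below) (sym (++-assoc (reading L) (reverse b') _)) ⟩
        ((reading L ++ reverse b') ++ suc i ∷ reverse a') ++ reverse below
          ≡⟨ ++-assoc (reading L ++ reverse b') (suc i ∷ reverse a') (reverse below) ⟩
        (reading L ++ reverse b') ++ suc i ∷ reverse a' ++ reverse below ∎
      neither : i ∈ reverse a' ⊎ i ∈ reverse below → ⊥
      neither (inj₂ m) = <-asym (below-> above C-strict (reverse⁻ m)) (n<1+n i)
      neither (inj₁ m) with above-≥ above a' (subst (λ z → Under _≤_ z _) f p) k (reverse⁻ m)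
      ... | t , t∈ , i≤t =
        no-low (subst (_∈ above) (≤-antisym (s≤s⁻¹ (above-< above C-strict t∈)) i≤t) t∈)

record Index (n : ℕ) : Set where
  field
    value   : ℕ
    1≤value : 1 ≤ value
    value<n : value < n

open Index public

nonempty-rows : ∀ {n μ} (T : SST n μ) → All (λ r → 0 < length r) (rows T)
nonempty-rows {μ = μ} T = Allₚ.map⁻ (subst (All (0 <_)) (sym (shape T)) (positive μ))

refill-lengths : ∀ cs w → length w ≡ length (concat cs) → map length (refill cs w) ≡ map length cs
refill-lengths []       w e = refl
refill-lengths (c ∷ cs) w e =
  cong₂ _∷_ (trans (length-reverse (take (length c) w))
                   (trans (length-take (length c) w) (m≤n⇒m⊓n≡m le)))
            (refill-lengths cs (drop (length c) w)
              (trans (length-drop (length c) w)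
                (trans (cong (_∸ length c) e')  (m+n∸m≡n (length c) _))))
  where
  e' : length w ≡ length c + length (concat cs)
  e' = trans e (length-++ c)
  le : length c ≤ length w
  le = subst (length c ≤_) (sym e') (m≤m+n (length c) _)

length-reading : ∀ cs → length (reading cs) ≡ length (concat cs)
length-reading []       = refl
length-reading (c ∷ cs) = trans (length-++ (reverse c))
  (trans (cong₂ _+_ (length-reverse c) (length-reading cs)) (sym (length-++ c)))

reading-refill : ∀ cs w → length w ≡ length (concat cs) → reading (refill cs w) ≡ w
reading-refill []       []  e = refl
reading-refill (c ∷ cs) w e =
  trans (cong₂ _++_ (reverse-involutive (take (length c) w))
          (reading-refill cs (drop (length c) w)
            (trans (length-drop (length c) w)
              (trans (cong (_∸ length c) (trans e (length-++ c))) (m+n∸m≡n (length c) _)))))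
        (take++drop≡id (length c) w)

CR-withReading : ∀ {n} T w → length w ≡ length (CR T) → GoodColumns n (refill (columns T) w) →
                 CR (withReading T w) ≡ w
CR-withReading T w e g = trans
  (cong reading (transpose-involutive nonempty (GoodColumns.weak g)))
  (reading-refill (columns T) w e')
  where
  e' : length w ≡ length (concat (columns T))
  e' = trans e (length-reading (columns T))
  nonempty : All (λ c → 0 < length c) (refill (columns T) w)
  nonempty = Allₚ.map⁻ (subst (All (0 <_)) (sym (refill-lengths (columns T) w e'))
                              (Allₚ.map⁺ (transpose-nonempty T)))

withReading-shape : ∀ {n μ} (T : SST n μ) w → length w ≡ length (CR (rows T)) →
                    map length (withReading (rows T) w) ≡ parts μ
withReading-shape T w e = begin
  map length (transpose (refill (columns (rows T)) w))
    ≡⟨ transpose-lengths _ _ (refill-lengths (columns (rows T)) w (trans e (length-reading (columns (rows T))))) ⟩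
  map length (transpose (columns (rows T)))
    ≡⟨ cong (map length) (transpose-involutive (nonempty-rows T) (columns-strict (semistandard T))) ⟩
  map length (rows T)
    ≡⟨ shape T ⟩
  _ ∎
  where open ≡-Reasoning

length-split : ∀ {i x y w w'} → Split i x y w w' → length w' ≡ length w
length-split {x = x} {y} (split u v refl refl _ _) = trans (length-++ u) (sym (length-++ u))

F̃ʷ-split : ∀ i w {w'} → F̃ʷ i w ≡ just w' → Split i i (suc i) w w'
F̃ʷ-split i w e with last (proj₁ (undeleted i w)) in eq
F̃ʷ-split i w refl | just k = proj₁ (F-split i w k eq)

Ẽʷ-split : ∀ i w {w'} → Ẽʷ i w ≡ just w' → Split i (suc i) i w w'
Ẽʷ-split i w e with head (proj₂ (undeleted i w)) in eq
Ẽʷ-split i w refl | just k = proj₁ (E-split i w k eq)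

module _ {n : ℕ} {μ : Partition} where

  φ ε : Index n → SST n μ → ℕ
  φ i T = φʷ (value i) (CR (rows T))
  ε i T = εʷ (value i) (CR (rows T))

  -- The tableau of shape μ with column reading w, if m is just w.
  refilled : (T : SST n μ) (m : Maybe Word) →
             (∀ w → m ≡ just w →
                length w ≡ length (CR (rows T)) × GoodColumns n (refill (columns (rows T)) w)) →
             Maybe (SST n μ)
  refilled T nothing  f = nothing
  refilled T (just w) f = just record
    { rows         = withReading (rows T) w
    ; shape        = withReading-shape T w (proj₁ (f w refl))
    ; semistandard = good-rows (proj₂ (f w refl))
    }

  F̃ Ẽ : Index n → SST n μ → Maybe (SST n μ)
  F̃ i T = refilled T (F̃ʷ (value i) (CR (rows T))) λ w e →
    let s = F̃ʷ-split (value i) (CR (rows T)) e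
    in length-split s , F-good (value<n i) (good-columns (semistandard T)) s
  Ẽ i T = refilled T (Ẽʷ (value i) (CR (rows T))) λ w e →
    let s = Ẽʷ-split (value i) (CR (rows T)) e
    in length-split s , E-good (1≤value i) (value<n i) (good-columns (semistandard T)) s

  CR-refilled : ∀ T m f → Maybe.map (CR ∘ rows) (refilled T m f) ≡ m
  CR-refilled T nothing  f = refl
  CR-refilled T (just w) f = cong just (CR-withReading (rows T) w (proj₁ (f w refl)) (proj₂ (f w refl)))

  CR-F̃ : ∀ i T → Maybe.map (CR ∘ rows) (F̃ i T) ≡ F̃ʷ (value i) (CR (rows T))
  CR-F̃ i T = CR-refilled T (F̃ʷ (value i) (CR (rows T))) _

  CR-Ẽ : ∀ i T → Maybe.map (CR ∘ rows) (Ẽ i T) ≡ Ẽʷ (value i) (CR (rows T))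
  CR-Ẽ i T = CR-refilled T (Ẽʷ (value i) (CR (rows T))) _

  deg : Index n → SST n μ → ℕ
  deg i T = if does (2 ∣? φ i T) then ε i T else suc (ε i T)

  B̃ : Index n → SST n μ → Maybe (SST n μ)
  B̃ i T = if does (2 ∣? φ i T) then Ẽ i T else F̃ i T

newRow : ℕ → List ℕ → List ℕ
newRow x r = proj₁ (rowInsert x r)

bumped : ℕ → List ℕ → Maybe ℕ
bumped x r = proj₂ (rowInsert x r)

∈-newRow : ∀ x r → x ∈ newRow x r
∈-newRow x []      = here refl
∈-newRow x (y ∷ r) with x <? y
... | yes _ = here refl
... | no _  = there (∈-newRow x r)

newRow-All : ∀ {Q : ℕ → Set} x r → Q x → All Q r → All Q (newRow x r)
newRow-All x []      q _        = q ∷ []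
newRow-All x (y ∷ r) q (p ∷ ps) with x <? y
... | yes _ = q ∷ ps
... | no _  = p ∷ newRow-All x r q ps

bumped-All : ∀ {Q : ℕ → Set} x r {y} → bumped x r ≡ just y → All Q r → Q y
bumped-All x (y ∷ r) e (p ∷ ps) with x <? y
bumped-All x (y ∷ r) refl (p ∷ ps) | yes _ = p
bumped-All x (y ∷ r) e    (p ∷ ps) | no _  = bumped-All x r e ps

bumped-> : ∀ x r {y} → bumped x r ≡ just y → x < y
bumped-> x (y ∷ r) e with x <? y
bumped-> x (y ∷ r) refl | yes p = p
bumped-> x (y ∷ r) e    | no _  = bumped-> x r e

newRow-weak : ∀ x r → Linked _≤_ r → Linked _≤_ (newRow x r)
newRow-weak x []      l = [-]
newRow-weak x (y ∷ r) l with x <? y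
... | yes p = lower p l
  where
  lower : ∀ {r} → x < y → Linked _≤_ (y ∷ r) → Linked _≤_ (x ∷ r)
  lower p [-]     = [-]
  lower p (q ∷ l) = ≤-trans (<⇒≤ p) q ∷ l
... | no p  = cons r (≮⇒≥ p) l (newRow-weak x r (Linked.tail l))
  where
  cons : ∀ r → y ≤ x → Linked _≤_ (y ∷ r) → Linked _≤_ (newRow x r) → Linked _≤_ (y ∷ newRow x r)
  cons []      p _       k = p ∷ k
  cons (z ∷ r) p (q ∷ _) k with x <? z
  ... | yes _ = p ∷ k
  ... | no _  = q ∷ k

newRow-under : ∀ x r {s} → Under _<_ r s → Under _<_ (newRow x r) s
newRow-under x r       []      = []
newRow-under x (y ∷ r) (p ∷ l) with x <? y
... | yes q = <-trans q p ∷ l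
... | no _  = p ∷ newRow-under x r l

newRow-under-bumped : ∀ x r {s y} → bumped x r ≡ just y → Under _<_ r s →
                      Under _<_ (newRow x r) (newRow y s)
newRow-under-bumped x (a ∷ r) e l with x <? a
newRow-under-bumped x (a ∷ r) refl []      | yes p = p ∷ []
newRow-under-bumped x (a ∷ r) refl (_∷_ {a = b} q l) | yes p with a <? b
... | yes _ = p ∷ l
... | no f  = ⊥-elim (f q)
newRow-under-bumped x (a ∷ r) e []      | no p = ≤-<-trans (≮⇒≥ p) (bumped-> x r e) ∷ []
newRow-under-bumped x (a ∷ r) {y = y} e (_∷_ {a = b} q l) | no p with y <? b
... | yes _ = ≤-<-trans (≮⇒≥ p) (bumped-> x r e) ∷ newRow-under x r l
... | no _  = q ∷ newRow-under-bumped x r e l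

insert-All : ∀ {Q : ℕ → Set} x T → Q x → All (All Q) T → All (All Q) (insert x T)
insert-All x []       q _        = (q ∷ []) ∷ []
insert-All x (r ∷ rs) q (p ∷ ps) with bumped x r in e
... | nothing = newRow-All x r q p ∷ ps
... | just y  = newRow-All x r q p ∷ insert-All y rs (bumped-All x r e p) ps

insert-weak : ∀ x T → All (Linked _≤_) T → All (Linked _≤_) (insert x T)
insert-weak x []       _        = [-] ∷ []
insert-weak x (r ∷ rs) (p ∷ ps) with bumped x r in e
... | nothing = newRow-weak x r p ∷ ps
... | just y  = newRow-weak x r p ∷ insert-weak y rs ps

insert-strict : ∀ x T → Linked (Under _<_) T → Linked (Under _<_) (insert x T)
insert-strict x []           _ = [-]
insert-strict x (r ∷ [])     _ with bumped x r in e
... | nothing = [-]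
... | just y  = newRow-under-bumped x r e [] ∷ [-]
insert-strict x (r ∷ s ∷ ss) (p ∷ l) with bumped x r in e
... | nothing = newRow-under x r p ∷ l
... | just y  = newRow-under-bumped x r e p ∷ insert-strict y (s ∷ ss) l

newRow-nonempty : ∀ x r → 0 < length (newRow x r)
newRow-nonempty x r with newRow x r | ∈-newRow x r
... | _ ∷ _ | _ = s≤s z≤n

insert-nonempty : ∀ x T → All (λ r → 0 < length r) T → All (λ r → 0 < length r) (insert x T)
insert-nonempty x []       _        = s≤s z≤n ∷ []
insert-nonempty x (r ∷ rs) (p ∷ ps) with bumped x r
... | nothing = newRow-nonempty x r ∷ ps
... | just y  = newRow-nonempty x r ∷ insert-nonempty y rs ps

newRow-length : ∀ x r → bumped x r ≡ nothing → length (newRow x r) ≡ suc (length r)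
newRow-length x []      e = refl
newRow-length x (y ∷ r) e with x <? y
... | no _ = cong suc (newRow-length x r e)

newRow-length-bumped : ∀ x r {y} → bumped x r ≡ just y → length (newRow x r) ≡ length r
newRow-length-bumped x (z ∷ r) e with x <? z
... | yes _ = refl
... | no _  = cong suc (newRow-length-bumped x r e)

insert-size : ∀ x T → length (concat (insert x T)) ≡ suc (length (concat T))
insert-size x []       = refl
insert-size x (r ∷ rs) with bumped x r in e
... | nothing = begin
  length (newRow x r ++ concat rs)           ≡⟨ length-++ (newRow x r) ⟩
  length (newRow x r) + length (concat rs)   ≡⟨ cong (_+ length (concat rs)) (newRow-length x r e) ⟩
  suc (length r + length (concat rs))        ≡⟨ cong suc (sym (length-++ r)) ⟩
  suc (length (r ++ concat rs))              ∎
  where open ≡-Reasoning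
... | just y  = begin
  length (newRow x r ++ concat (insert y rs))         ≡⟨ length-++ (newRow x r) ⟩
  length (newRow x r) + length (concat (insert y rs)) ≡⟨ cong₂ _+_ (newRow-length-bumped x r e) (insert-size y rs) ⟩
  length r + suc (length (concat rs))                 ≡⟨ +-suc (length r) _ ⟩
  suc (length r + length (concat rs))                 ≡⟨ cong suc (sym (length-++ r)) ⟩
  suc (length (r ++ concat rs))                       ∎
  where open ≡-Reasoning

insertAll : Rows → Word → Rows
insertAll = foldl (flip insert)

insertAll-semistandard : ∀ {n} T w → All (Bounded n) w → Semistandard n T → Semistandard n (insertAll T w)
insertAll-semistandard T []      _        s = s
insertAll-semistandard T (x ∷ w) (q ∷ qs) s = insertAll-semistandard (insert x T) w qs record
  { bounds         = insert-All x T q (bounds s)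
  ; rows-weak      = insert-weak x T (rows-weak s)
  ; columns-strict = insert-strict x T (columns-strict s)
  }

P-semistandard : ∀ {n w} → All (Bounded n) w → Semistandard n (P w)
P-semistandard {w = w} q = insertAll-semistandard [] w q
  record { bounds = [] ; rows-weak = [] ; columns-strict = [] }

insertAll-nonempty : ∀ T w → All (λ r → 0 < length r) T → All (λ r → 0 < length r) (insertAll T w)
insertAll-nonempty T []      p = p
insertAll-nonempty T (x ∷ w) p = insertAll-nonempty (insert x T) w (insert-nonempty x T p)

insertAll-size : ∀ T w → length (concat (insertAll T w)) ≡ length (concat T) + length w
insertAll-size T []      = sym (+-identityʳ _)
insertAll-size T (x ∷ w) = begin
  length (concat (insertAll (insert x T) w))   ≡⟨ insertAll-size (insert x T) w ⟩
  length (concat (insert x T)) + length w      ≡⟨ cong (_+ length w) (insert-size x T) ⟩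
  suc (length (concat T) + length w)           ≡⟨ sym (+-suc (length (concat T)) (length w)) ⟩
  length (concat T) + suc (length w)           ∎
  where open ≡-Reasoning

_?∷ʷ_ : Maybe ℕ → Word → Word
nothing ?∷ʷ w = w
just x  ?∷ʷ w = x ∷ w

output : List ℕ → Word → Word
output r []      = []
output r (x ∷ w) = bumped x r ?∷ʷ output (newRow x r) w

insertAll-∷ : ∀ r rs w → ∃[ r' ] insertAll (r ∷ rs) w ≡ r' ∷ insertAll rs (output r w)
insertAll-∷ r rs []      = r , refl
insertAll-∷ r rs (x ∷ w) with bumped x r
... | nothing = insertAll-∷ (newRow x r) rs w
... | just y  = insertAll-∷ (newRow x r) (insert y rs) w

?∷ʷ-⊆ : ∀ m {s w} → s ⊆ w → s ⊆ (m ?∷ʷ w)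
?∷ʷ-⊆ nothing  τ = τ
?∷ʷ-⊆ (just x) τ = x ∷ʳ τ

bumped-≤ : ∀ x r {e} → Linked _≤_ r → e ∈ r → x < e → ∃[ z ] bumped x r ≡ just z × z ≤ e
bumped-≤ x (y ∷ r) l m p with x <? y
... | yes _ = y , refl , first l m
  where
  first : ∀ {y r e} → Linked _≤_ (y ∷ r) → e ∈ y ∷ r → y ≤ e
  first l       (here refl) = ≤-refl
  first (q ∷ l) (there m)   = ≤-trans q (first l m)
bumped-≤ x (y ∷ r) l (here refl) p | no q = ⊥-elim (q p)
bumped-≤ x (y ∷ r) l (there m)   p | no _ = bumped-≤ x r (Linked.tail l) m p

newRow-keeps : ∀ x r {e} → e ∈ r → e ∈ newRow x r ⊎ (bumped x r ≡ just e × x < e)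
newRow-keeps x (y ∷ r) m with x <? y
newRow-keeps x (y ∷ r) (here refl) | yes p = inj₂ (refl , p)
newRow-keeps x (y ∷ r) (there m)   | yes _ = inj₁ (there m)
newRow-keeps x (y ∷ r) (here refl) | no _  = inj₁ (here refl)
newRow-keeps x (y ∷ r) (there m)   | no _ with newRow-keeps x r m
... | inj₁ k = inj₁ (there k)
... | inj₂ k = inj₂ k

record Decreasing (k b : ℕ) (w : Word) : Set where
  constructor decr
  field
    letters : Word
    subword : letters ⊆ w
    strict  : Linked _>_ letters
    ≤bound  : All (_≤ b) letters
    count   : length letters ≡ k

decr-weaken : ∀ {k b w} m → Decreasing k b w → Decreasing k b (m ?∷ʷ w)
decr-weaken m (decr s τ l p c) = decr s (?∷ʷ-⊆ m τ) l p c

decr-cons : ∀ {k b b' z w} → Decreasing k b w → b < z → z ≤ b' → Decreasing (suc k) b' (z ∷ w)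
decr-cons {z = z} (decr s τ l p c) b<z z≤b' =
  decr (z ∷ s) (refl ∷ τ) (cons l p) (z≤b' ∷ All.map (λ q → ≤-trans q (≤-trans (<⇒≤ b<z) z≤b')) p)
       (cong suc c)
  where
  cons : ∀ {s} → Linked _>_ s → All (_≤ _) s → Linked _>_ (z ∷ s)
  cons []      _       = [-]
  cons [-]     (p ∷ _) = ≤-<-trans p b<z ∷ [-]
  cons (q ∷ l) (p ∷ _) = ≤-<-trans p b<z ∷ q ∷ l

output-with : ∀ {r e x s w} → Linked _≤_ r → e ∈ r → e ≤ x → s ⊆ w → Linked _>_ (e ∷ s) →
              Decreasing (length s) x (output r w)
output-any  : ∀ {r y s w} → Linked _≤_ r → (y ∷ s) ⊆ w → Linked _>_ (y ∷ s) →
              Decreasing (length s) y (output r w)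

output-with {s = []}    l m e≤x τ _ = decr [] (minimum _) [] [] refl
output-with {r} {e} {s = y ∷ s} l m e≤x (refl ∷ τ) (y<e ∷ d) with bumped-≤ y r l m y<e
... | z , f , z≤e rewrite f =
  decr-cons (output-with (newRow-weak y r l) (∈-newRow y r) ≤-refl τ d) (bumped-> y r f)
            (≤-trans z≤e e≤x)
output-with {r} {e} {s = y ∷ s} l m e≤x (v ∷ʳ τ) (y<e ∷ d) with newRow-keeps v r m
... | inj₁ k = decr-weaken (bumped v r) (output-with (newRow-weak v r l) k e≤x τ (y<e ∷ d))
... | inj₂ (f , v<e) rewrite f with y <? v
...   | yes y<v = decr-weaken (just e)
  (output-with (newRow-weak v r l) (∈-newRow v r) (≤-trans (<⇒≤ v<e) e≤x) τ (y<v ∷ d))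
...   | no _    = decr-cons (output-any (newRow-weak v r l) τ d) y<e e≤x

output-any {r} {y} l (refl ∷ τ) d =
  decr-weaken (bumped y r) (output-with (newRow-weak y r l) (∈-newRow y r) ≤-refl τ d)
output-any {r} l (v ∷ʳ τ) d = decr-weaken (bumped v r) (output-any (newRow-weak v r l) τ d)

-- A strictly decreasing subword of w is at most as long as the first column
-- of P w.
P-rows : ∀ k {s w} → length s ≡ k → s ⊆ w → Linked _>_ s → k ≤ length (P w)
P-rows zero    e τ d = z≤n
P-rows (suc k) {_ ∷ _} {w@(x ∷ _)} e τ d with output-any [] τ d | insertAll-∷ [] [] w
... | decr s' τ' d' _ c | r' , f =
  subst (λ T → suc k ≤ length T) (sym f)
        (s≤s (P-rows k (trans c (suc-injective e)) τ' d'))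

complement : ℕ → List ℕ → List ℕ
complement n C = filter (λ x → ¬? (x ∈? C)) (applyUpTo suc n)

K₁ʷ : ℕ → Rows → Word
K₁ʷ n T = reading (complement n (column 0 T) ∷ drop 1 (columns T))

reading-All : ∀ {Q : ℕ → Set} {cs} → All (All Q) cs → All Q (reading cs)
reading-All []       = []
reading-All (p ∷ ps) = Allₚ.++⁺ (reverse-All p) (reading-All ps)
  where
  reverse-All : ∀ {Q : ℕ → Set} {c} → All Q c → All Q (reverse c)
  reverse-All p = All.tabulate (λ m → All.lookup p (reverse⁻ m))

complement-bounded : ∀ n C → All (Bounded n) (complement n C)
complement-bounded n C = All.tabulate bounded
  where
  bounded : ∀ {x} → x ∈ complement n C → Bounded n x
  bounded m with ∈-applyUpTo⁻ suc (proj₁ (∈-filter⁻ (λ x → ¬? (x ∈? C)) {xs = applyUpTo suc n} m))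
  ... | i , i<n , refl = s≤s z≤n , i<n

K₁ʷ-bounded : ∀ {n T} → Semistandard n T → All (Bounded n) (K₁ʷ n T)
K₁ʷ-bounded {n} {T} s =
  reading-All (complement-bounded n (column 0 T) ∷ Allₚ.drop⁺ 1 (transpose-All (bounds s)))

unique-≤ : ∀ {xs ys : List ℕ} → Unique xs → (∀ {x} → x ∈ xs → x ∈ ys) → length xs ≤ length ys
unique-≤ {[]}     _ _ = z≤n
unique-≤ {x ∷ xs} {ys} (p AllPairs.∷ ps) f with u , v , refl ← ∈-∃++ (f (here refl)) =
  subst (suc (length xs) ≤_) (sym (trans (length-++ u) (+-suc (length u) (length v))))
    (s≤s (subst (length xs ≤_) (length-++ u) (unique-≤ ps without)))
  where
  without : ∀ {z} → z ∈ xs → z ∈ u ++ v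
  without m with ∈-++⁻ u (f (there m))
  ... | inj₁ k           = ∈-++⁺ˡ k
  ... | inj₂ (here refl) = ⊥-elim (All.lookup p m refl)
  ... | inj₂ (there k)   = ∈-++⁺ʳ u k

unique-strict : ∀ {C} → Linked _<_ C → Unique C
unique-strict l = AllPairs.map <⇒≢ (Linkedₚ.Linked⇒AllPairs <-trans l)

interval-strict : ∀ n → Linked _<_ (applyUpTo suc n)
interval-strict n = Linkedₚ.applyUpTo⁺₂ suc n (λ i → n<1+n (suc i))

complement-strict : ∀ n C → Linked _<_ (complement n C)
complement-strict n C = Linkedₚ.filter⁺ (λ x → ¬? (x ∈? C)) <-trans (interval-strict n)

complement-length : ∀ {n C} → Linked _<_ C → All (Bounded n) C →
                    length C + length (complement n C) ≡ n
complement-length {n} {C} l b = ≤-antisym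
  (subst₂ _≤_ (length-++ C) (length-applyUpTo suc n)
    (unique-≤ (Uniqueₚ.++⁺ (unique-strict l) (unique-strict (complement-strict n C)) disjoint) into))
  (subst₂ _≤_ (length-applyUpTo suc n) (length-++ C)
    (unique-≤ (unique-strict (interval-strict n)) cover))
  where
  outside? : ∀ x → Dec (x ∉ C)
  outside? x = ¬? (x ∈? C)
  disjoint : ∀ {x} → x ∈ C × x ∈ complement n C → ⊥
  disjoint (m , k) = proj₂ (∈-filter⁻ outside? {xs = applyUpTo suc n} k) m
  into : ∀ {x} → x ∈ C ++ complement n C → x ∈ applyUpTo suc n
  into m with ∈-++⁻ C m
  ... | inj₂ k = proj₁ (∈-filter⁻ outside? {xs = applyUpTo suc n} k)
  ... | inj₁ k with All.lookup b k
  ...   | s≤s z≤n , q = ∈-applyUpTo⁺ suc q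
  cover : ∀ {x} → x ∈ applyUpTo suc n → x ∈ C ++ complement n C
  cover {x} m with x ∈? C
  ... | yes k = ∈-++⁺ˡ k
  ... | no k  = ∈-++⁺ʳ C (∈-filter⁺ outside? m k)

column₀-length : ∀ {T} → All (λ r → 0 < length r) T → length (column 0 T) ≡ length T
column₀-length []       = refl
column₀-length {(x ∷ r) ∷ T} (p ∷ ps) = trans (extend (columns T)) (cong suc (column₀-length ps))
  where
  extend : ∀ cs → length (fromMaybe [] (head (consRow (x ∷ r) cs))) ≡ suc (length (fromMaybe [] (head cs)))
  extend []      = refl
  extend (_ ∷ _) = refl

first-All : ∀ {Q : List ℕ → Set} {cs} → Q [] → All Q cs → Q (fromMaybe [] (head cs))
first-All q []      = q
first-All q (p ∷ _) = p

column-strict : ∀ {n T} j → Semistandard n T → Linked _<_ (column j T)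
column-strict j s = first-All [] (Allₚ.drop⁺ j (GoodColumns.strict (good-columns s)))

column-bounded : ∀ {n T} j → Semistandard n T → All (Bounded n) (column j T)
column-bounded j s = first-All [] (Allₚ.drop⁺ j (GoodColumns.bounded (good-columns s)))

toSST : ∀ {n T} l → Semistandard n T → All (λ r → 0 < length r) T → length T ≤ l →
        Σ[ μ ∈ Par l ] SST n (proj₁ μ)
toSST {T = T} l s p q = (record
  { parts      = map length T
  ; decreasing = Linkedₚ.map⁺ (Linked.map length-mono (columns-strict s))
  ; positive   = Allₚ.map⁺ p
  } , subst (_≤ l) (sym (length-map length T)) q) ,
  record { rows = T ; shape = refl ; semistandard = s }

rows≤n : ∀ {n T} → Semistandard n T → All (λ r → 0 < length r) T → length T ≤ n
rows≤n {n} {T} s p = subst₂ _≤_ (column₀-length p)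
  (complement-length (column-strict 0 s) (column-bounded 0 s)) (m≤m+n (length (column 0 T)) _)

K₁ : ∀ {n} → SST⊔ n → SST⊔ n
K₁ {n} (μ , T) = toSST {T = P (K₁ʷ n (rows T))} n sem ne (rows≤n sem ne)
  where
  sem = P-semistandard (K₁ʷ-bounded (semistandard T))
  ne  = insertAll-nonempty [] (K₁ʷ n (rows T)) []

-- With d₁ ≤ ⌊n/2⌋ there are at least d₂ entries in the complement of the first
-- column, so the second condition compares all d₂ entries of the second column.
IsAI : ℕ → Rows → Set
IsAI n T = length (column 0 T) ≤ ⌊ n /2⌋ × Under _≤_ (complement n (column 0 T)) (column 1 T)

IsAI? : ∀ n T → Dec (IsAI n T)
IsAI? n T = length (column 0 T) ≤? ⌊ n /2⌋ ×-dec prefix? (flip _≤?_) (column 1 T) (complement n (column 0 T))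

record SSTᴬᴵ (n : ℕ) (ρ : Partition) : Set where
  field
    tableau : SST n ρ
    isAI    : IsAI n (rows tableau)

open SSTᴬᴵ public

SSTᴬᴵ⊔ : ℕ → Set
SSTᴬᴵ⊔ n = Σ[ ρ ∈ Par ⌊ n /2⌋ ] SSTᴬᴵ n (proj₁ ρ)

snoc-linked : ∀ {s y} → Linked _>_ s → All (y <_) s → Linked _>_ (s ++ y ∷ [])
snoc-linked []      _            = [-]
snoc-linked [-]     (p ∷ [])     = p ∷ [-]
snoc-linked (q ∷ l) (_ ∷ p ∷ ps) = q ∷ snoc-linked l (p ∷ ps)

reverse-linked : ∀ {s} → Linked _<_ s → Linked _>_ (reverse s)
reverse-linked {[]}    l = []
reverse-linked {x ∷ s} l = subst (Linked _>_) (sym (unfold-reverse x s))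
  (snoc-linked (reverse-linked (Linked.tail l)) (All.tabulate (λ m → linked-< l (reverse⁻ m))))

obstruction : ∀ {K D} → Linked _<_ K → Linked _<_ D → length D ≤ length K → ¬ Under _≤_ K D →
              ∃[ s ] Linked _<_ s × s ⊆ (D ++ K) × length s ≡ suc (length K) ×
                     (∀ {t} → All (t <_) D → All (t <_) s)
obstruction {K}     {[]}    _ _ _       f = ⊥-elim (f [])
obstruction {x ∷ K} {y ∷ D} k d (s≤s q) f with x ≤? y
... | no x≰y = y ∷ x ∷ K , ≰⇒> x≰y ∷ k , refl ∷ Sublistₚ.++⁺ˡ D ⊆-refl , refl ,
  λ { (p ∷ _) → p ∷ <-trans p (≰⇒> x≰y) ∷ All.tabulate (λ m → <-trans p (<-trans (≰⇒> x≰y) (linked-< k m))) }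
... | yes x≤y with obstruction (Linked.tail k) (Linked.tail d) q (λ u → f (x≤y ∷ u))
...   | s , l , τ , c , g = y ∷ s , cons l (g (All.tabulate (linked-< d))) ,
  refl ∷ ⊆-trans τ (Sublistₚ.++⁺ (⊆-refl {x = D}) (x ∷ʳ ⊆-refl)) , cong suc c ,
  λ { (p ∷ _) → p ∷ All.map (<-trans p) (g (All.tabulate (linked-< d))) }
  where
  cons : ∀ {s} → Linked _<_ s → All (y <_) s → Linked _<_ (y ∷ s)
  cons []      _       = [-]
  cons [-]     (p ∷ _) = p ∷ [-]
  cons (q ∷ l) (p ∷ _) = p ∷ q ∷ l

size : ∀ {n} → SST⊔ n → ℕ
size (_ , T) = length (CR (rows T))

d₁ : ∀ {n} → SST⊔ n → ℕ
d₁ (_ , T) = length (column 0 (rows T))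

IsAI⊔ : ∀ {n} → SST⊔ n → Set
IsAI⊔ {n} (_ , T) = IsAI n (rows T)

consRow-size : ∀ r cs → length (concat (consRow r cs)) ≡ length r + length (concat cs)
consRow-size []      cs       = refl
consRow-size (x ∷ r) []       = cong suc (consRow-size r [])
consRow-size (x ∷ r) (c ∷ cs) = cong suc (begin
  length (c ++ concat (consRow r cs))          ≡⟨ length-++ c ⟩
  length c + length (concat (consRow r cs))    ≡⟨ cong (length c +_) (consRow-size r cs) ⟩
  length c + (length r + length (concat cs))   ≡⟨ sym (+-assoc (length c) (length r) _) ⟩
  length c + length r + length (concat cs)     ≡⟨ cong (_+ length (concat cs)) (+-comm (length c) (length r)) ⟩
  length r + length c + length (concat cs)     ≡⟨ +-assoc (length r) (length c) _ ⟩
  length r + (length c + length (concat cs))   ≡⟨ cong (length r +_) (sym (length-++ c)) ⟩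
  length r + length (c ++ concat cs)           ∎)
  where open ≡-Reasoning

CR-size : ∀ T → length (CR T) ≡ length (concat T)
CR-size T = trans (length-reading (columns T)) (transpose-size T)
  where
  transpose-size : ∀ T → length (concat (transpose T)) ≡ length (concat T)
  transpose-size []      = refl
  transpose-size (r ∷ T) = trans (consRow-size r (transpose T))
    (trans (cong (length r +_) (transpose-size T)) (sym (length-++ r)))

-- rest is the number of entries outside the first column and c the size of the
-- complement of the first column.
sizes : ∀ {n} (T : SST⊔ n) → ∃[ c ] ∃[ rest ]
        c ≡ length (complement n (column 0 (rows (proj₂ T)))) ×
        d₁ T + c ≡ n × size T ≡ d₁ T + rest × size (K₁ T) ≡ c + rest
sizes {n} (μ , T) = _ , length (reading (drop 1 (columns (rows T)))) , refl ,
  complement-length (column-strict 0 (semistandard T)) (column-bounded 0 (semistandard T)) ,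
  decompose (columns (rows T)) ,
  trans (CR-size (P (K₁ʷ n (rows T)))) (trans (insertAll-size [] (K₁ʷ n (rows T)))
    (first (complement n (column 0 (rows T))) (drop 1 (columns (rows T)))))
  where
  first : ∀ c cs → length (reading (c ∷ cs)) ≡ length c + length (reading cs)
  first c cs = trans (length-++ (reverse c)) (cong (_+ length (reading cs)) (length-reverse c))
  decompose : ∀ cs → length (reading cs) ≡ length (fromMaybe [] (head cs)) + length (reading (drop 1 cs))
  decompose []       = refl
  decompose (c ∷ cs) = first c cs

n≤m+1+m : ∀ n → n ≤ ⌊ n /2⌋ + suc ⌊ n /2⌋
n≤m+1+m zero          = z≤n
n≤m+1+m (suc zero)    = s≤s z≤n
n≤m+1+m (suc (suc n)) = s≤s (subst (suc n ≤_) (sym (+-suc ⌊ n /2⌋ (suc ⌊ n /2⌋))) (s≤s (n≤m+1+m n)))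

m+m≤n : ∀ n → ⌊ n /2⌋ + ⌊ n /2⌋ ≤ n
m+m≤n zero          = z≤n
m+m≤n (suc zero)    = z≤n
m+m≤n (suc (suc n)) = s≤s (subst (_≤ suc n) (sym (+-suc ⌊ n /2⌋ ⌊ n /2⌋)) (s≤s (m+m≤n n)))

long-shrinks : ∀ {n} (T : SST⊔ n) → ¬ d₁ T ≤ ⌊ n /2⌋ → size (K₁ T) < size T
long-shrinks {n} T f with c , rest , _ , e , p , q ← sizes T =
  subst₂ _<_ (sym q) (sym p) (+-monoˡ-< rest (≰⇒> λ d≤c →
    <⇒≱ (subst (⌊ n /2⌋ + suc ⌊ n /2⌋ <_) e (+-mono-≤ (≰⇒> f) (≤-trans (≰⇒> f) d≤c))) (n≤m+1+m n)))

short-complement : ∀ {n d c} → d ≤ ⌊ n /2⌋ → d + c ≡ n → ⌊ n /2⌋ ≤ c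
short-complement {n} {d} {c} d≤m e =
  +-cancelˡ-≤ ⌊ n /2⌋ ⌊ n /2⌋ c (≤-trans (m+m≤n n) (subst (_≤ ⌊ n /2⌋ + c) e (+-monoˡ-≤ c d≤m)))

short-grows : ∀ {n} (T : SST⊔ n) → d₁ T ≤ ⌊ n /2⌋ → ¬ IsAI⊔ T →
              length (complement n (column 0 (rows (proj₂ T)))) < d₁ (K₁ T)
short-grows {n} (μ , T) d≤m f with
  obstruction (complement-strict n (column 0 (rows T))) (column-strict 1 (semistandard T))
    (≤-trans (second≤first (GoodColumns.weak (good-columns (semistandard T))))
      (≤-trans d≤m (short-complement d≤m
        (complement-length (column-strict 0 (semistandard T)) (column-bounded 0 (semistandard T))))))
    (λ u → f (d≤m , u))
  where
  second≤first : ∀ {cs} → Linked (Under _≤_) cs →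
                 length (fromMaybe [] (head (drop 1 cs))) ≤ length (fromMaybe [] (head cs))
  second≤first []      = z≤n
  second≤first [-]     = z≤n
  second≤first (u ∷ _) = length-mono u
... | s , l , τ , c , _ =
  subst (length K <_) (sym (column₀-length (insertAll-nonempty [] (K₁ʷ n (rows T)) [])))
    (P-rows (suc (length K)) (trans (length-reverse s) c)
      (⊆-trans (subst (reverse s ⊆_) (reverse-++ D K) (Sublistₚ.reverse⁺ τ))
               (Sublistₚ.++⁺ (⊆-refl {x = reverse K}) (first-⊆ (drop 1 (columns (rows T))))))
      (reverse-linked l))
  where
  K = complement n (column 0 (rows T))
  D = column 1 (rows T)
  first-⊆ : ∀ cs → reverse (fromMaybe [] (head cs)) ⊆ reading cs
  first-⊆ []       = []
  first-⊆ (c ∷ cs) = Sublistₚ.++⁺ʳ (reading cs) ⊆-refl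

short-shrinks : ∀ {n} (T : SST⊔ n) → d₁ T ≤ ⌊ n /2⌋ → ¬ IsAI⊔ T →
                ¬ d₁ (K₁ T) ≤ ⌊ n /2⌋ × size (K₁ (K₁ T)) < size T
short-shrinks {n} T d≤m f
  with c , rest , refl , e , p , q ← sizes T | c' , rest' , _ , e' , p' , q' ← sizes (K₁ T) =
  <⇒≱ (≤-<-trans (short-complement d≤m e) grows) ,
  subst₂ _<_ (sym q') (sym p) (+-mono-< c'<d rest'<rest)
  where
  grows : c < d₁ (K₁ T)
  grows = short-grows T d≤m f
  c'<d : c' < d₁ T
  c'<d = +-cancelʳ-< c c' (d₁ T) (subst (c' + c <_) (trans (+-comm c' (d₁ (K₁ T))) (trans e' (sym e)))
           (+-monoʳ-< c' grows))
  rest'<rest : rest' < rest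
  rest'<rest = +-cancelˡ-< c rest' rest (subst (c + rest' <_) (trans (sym p') q) (+-monoˡ-< rest' grows))

Reaches : ∀ {n} → SST⊔ n → Set
Reaches T = ∃[ r ] IsAI⊔ (iterate K₁ T r) × (∀ s → s < r → ¬ IsAI⊔ (iterate K₁ T s))

later : ∀ {n} (T : SST⊔ n) → ¬ IsAI⊔ T → Reaches (K₁ T) → Reaches T
later T f (r , g , h) = suc r , g , λ { zero _ → f ; (suc s) (s≤s q) → h s q }

-- If d₁ > ⌊n/2⌋ then K₁ removes cells.  Otherwise, unless T is an AI-tableau,
-- the first column of K₁ T is so long that K₁ (K₁ T) has fewer cells than T.
reaches : ∀ {n} (T : SST⊔ n) → Reaches T
reaches T = go T (<-wellFounded (size T))
  where
  go : ∀ {n} (T : SST⊔ n) → Acc _<_ (size T) → Reaches T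
  go {n} T (acc rs) with IsAI? n (rows (proj₂ T))
  ... | yes g = 0 , g , λ _ ()
  ... | no f with d₁ T ≤? ⌊ n /2⌋
  ...   | no g  = later T f (go (K₁ T) (rs (long-shrinks T g)))
  ...   | yes g with short-shrinks T g f
  ...     | h , l = later T f (later (K₁ T) (h ∘ proj₁) (go (K₁ (K₁ T)) (rs l)))

toAI : ∀ {n} (T : SST⊔ n) → IsAI⊔ T → SSTᴬᴵ⊔ n
toAI {n} ((μ , _) , T) g = (μ , subst (_≤ ⌊ n /2⌋) d₁≡ℓ (proj₁ g)) , record { tableau = T ; isAI = g }
  where
  open ≡-Reasoning
  d₁≡ℓ : length (column 0 (rows T)) ≡ length (parts μ)
  d₁≡ℓ = begin
    length (column 0 (rows T))      ≡⟨ column₀-length (nonempty-rows T) ⟩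
    length (rows T)                 ≡⟨ sym (length-map length (rows T)) ⟩
    length (map length (rows T))    ≡⟨ cong length (shape T) ⟩
    length (parts μ)                ∎

-- The exponent of K₁ found by reaches is minimal, by the last component of Reaches.
Pᴬᴵ : ∀ {n} → SST⊔ n → SSTᴬᴵ⊔ n
Pᴬᴵ T = toAI (iterate K₁ T (proj₁ (reaches T))) (proj₁ (proj₂ (reaches T)))

B̃⊔ : ∀ {n} → Index n → SST⊔ n → Maybe (SST⊔ n)
B̃⊔ i (μ , T) = Maybe.map (μ ,_) (B̃ i T)

-- A tableau is determined by its rows, so equality of tableaux is stated on rows.
-- nothing stands for 0, and f is extended by f 0 = 0.  The B̃ i of an AI-tableau is
-- taken in SST n, whose structure the AI-tableaux carry by restriction.
record IsMorphism {n : ℕ} (f : SST⊔ n → SSTᴬᴵ⊔ n) : Set where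
  field
    B̃-homo   : ∀ i T → Maybe.map (rows ∘ tableau ∘ proj₂ ∘ f) (B̃⊔ i T) ≡
                        Maybe.map rows (B̃ i (tableau (proj₂ (f T))))
    deg-homo : ∀ i T → deg i (tableau (proj₂ (f T))) ≡ deg i (proj₂ T)

{-# OPTIONS --safe #-}
-- Write φ and ε for the numbers of undeleted i and i+1 of a word.  The signature (φ, ε)
-- of a concatenation is determined by those of its factors (_⊗_), and Knuth moves keep
-- the signature and commute with the letter changes F̃ and Ẽ.  Since P is invariant under
-- Knuth moves and CR (P w) is Knuth equivalent to w, everything can be computed on words.
--
-- Replacing the first column by its complement exchanges the signatures (1 , 0) and
-- (0 , 1) and keeps (0 , 0).  By the rule for concatenations this changes φ by 0 or ± 2
-- and keeps ε when the letters behind the column have φ > 0, and exchanges the odd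
-- signature (1 , ε) with (0 , ε + 1) otherwise; in all cases deg is kept and the letter
-- changed by B̃ is matched.  So K₁ commutes with deg and B̃.
--
-- Finally T is an AI-tableau if and only if d₁ ≤ ⌊n/2⌋ and the first column of K₁ T is no
-- longer than the complement of that of T.  As B̃ keeps shapes, it keeps this condition
-- along the orbit of K₁, so that the number of iterations of K₁ is the same.

module Submission where

open import Defs

open import Data.Bool.Base using (Bool; true; false; not; if_then_else_)
open import Data.Empty using (⊥; ⊥-elim)
open import Data.List.Base
  using (List; []; _∷_; _++_; _[_]∷=_; applyUpTo; drop; filter; foldl; head; last; length; map; reverse; take)
open import Data.List.Membership.Propositional using (_∈_; _∉_)
open import Data.List.Membership.Propositional.Properties
  using (∈-++⁺ˡ; ∈-++⁺ʳ; ∈-++⁻; ∈-∃++; ∈-filter⁺; ∈-filter⁻; ∈-applyUpTo⁺)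
open import Data.List.Properties
  using (++-assoc; ++-identityʳ; filter-++; filter-accept; filter-reject; foldl-++; length-++;
         length-reverse; reverse-injective; reverse-involutive; unfold-reverse; ∷-injectiveˡ)
open import Data.List.Relation.Binary.Prefix.Heterogeneous using (Prefix; []; _∷_)
open import Data.List.Relation.Unary.All as All using (All; []; _∷_)
import Data.List.Relation.Unary.All.Properties as Allₚ
open import Data.List.Relation.Unary.Any using (here; there)
open import Data.List.Relation.Unary.Any.Properties using (reverse⁺; reverse⁻)
open import Data.List.Relation.Unary.Linked as Linked using (Linked; []; [-]; _∷_)
open import Data.Maybe.Base as Maybe using (Maybe; just; nothing; fromMaybe)
open import Data.Nat.Base
open import Data.Nat.Divisibility using (_∣?_)
open import Data.Nat.GeneralisedArithmetic using (iterate)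
open import Data.Nat.Properties
open import Data.List.Membership.DecPropositional _≟_ using (_∈?_)
open import Data.Product.Base using (∃-syntax; _×_; _,_; proj₁; proj₂)
open import Data.Sum.Base using (_⊎_; inj₁; inj₂; [_,_]′)
open import Function.Base using (_∘_; flip)
open import Level using (0ℓ)
open import Relation.Binary.Construct.Closure.Equivalence as Eq using (EqClosure)
open import Relation.Binary.Core using (Rel)
open import Relation.Binary.Definitions using (tri<; tri≈; tri>)
open import Relation.Binary.PropositionalEquality
open import Relation.Binary.Structures using (IsEquivalence)
open import Relation.Nullary using (does; yes; no; ¬?)

-- Signatures of words
Signature : Set
Signature = ℕ × ℕ

signature : ℕ → Word → Signature
signature i w = φʷ i w , εʷ i w

act : ∀ {i x} → Letter i x → Signature → Signature
act low         (a     , b) = suc a , b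
act high        (zero  , b) = zero , suc b
act high        (suc a , b) = a , b
act (other _ _) s           = s

signature-∷ : ∀ {i x} (l : Letter i x) w → signature i (x ∷ w) ≡ act l (signature i w)
signature-∷ {i} low         w = cong₂ _,_ (φ-low i w) (ε-low i w)
signature-∷     (other p q) w = cong₂ _,_ (φ-other w p q) (ε-other w p q)
signature-∷ {i} high        w with φʷ i w in e
... | zero  = cong₂ _,_ (trans (φ-high i w) (cong pred e)) (ε-high₀ i w e)
... | suc _ = cong₂ _,_ (trans (φ-high i w) (cong pred e)) (ε-high₊ i w (λ z → 1+n≢0 (trans (sym e) z)))

signature-∷₃ : ∀ i a b c w → signature i (a ∷ b ∷ c ∷ w) ≡
               act (letter i a) (act (letter i b) (act (letter i c) (signature i w)))
signature-∷₃ i a b c w = trans (signature-∷ (letter i a) (b ∷ c ∷ w)) (cong (act (letter i a))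
  (trans (signature-∷ (letter i b) (c ∷ w)) (cong (act (letter i b)) (signature-∷ (letter i c) w))))

signature-∷-cong : ∀ i x w v → signature i w ≡ signature i v →
                   signature i (x ∷ w) ≡ signature i (x ∷ v)
signature-∷-cong i x w v e =
  trans (signature-∷ (letter i x) w) (trans (cong (act (letter i x)) e) (sym (signature-∷ (letter i x) v)))

φ-∷-cong : ∀ i x w v → φʷ i w ≡ φʷ i v → φʷ i (x ∷ w) ≡ φʷ i (x ∷ v)
φ-∷-cong i x w v e with letter i x
... | low       = trans (φ-low i w) (trans (cong suc e) (sym (φ-low i v)))
... | high      = trans (φ-high i w) (trans (cong pred e) (sym (φ-high i v)))
... | other p q = trans (φ-other w p q) (trans e (sym (φ-other v p q)))

infixr 7 _⊗_

-- The tensor product rule: between `i^a (i+1)^b` and `i^c (i+1)^d`, the `b` letters `i+1` on the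
-- left cancel against the `c` letters `i` on the right.
_⊗_ : Signature → Signature → Signature
(a , b) ⊗ (c , d) = a + (c ∸ b) , d + (b ∸ c)

act-⊗ : ∀ {i x} (l : Letter i x) s t → act l (s ⊗ t) ≡ act l s ⊗ t
act-⊗ low         _           _       = refl
act-⊗ (other _ _) _           _       = refl
act-⊗ high        (suc a , b) _       = refl
act-⊗ {i} high    (zero  , b) (c , d) = go b c
  where
  go : ∀ b c → act (high {i}) (c ∸ b , d + (b ∸ c)) ≡ (c ∸ suc b , d + (suc b ∸ c))
  go zero    zero    = cong (0 ,_) (sym (+-suc d 0))
  go zero    (suc c) = cong (λ z → c , d + z) (sym (0∸n≡0 c))
  go (suc b) zero    = cong (0 ,_) (sym (+-suc d (suc b)))
  go (suc b) (suc c) = go b c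

signature-++ : ∀ i u v → signature i (u ++ v) ≡ signature i u ⊗ signature i v
signature-++ i []      v = cong₂ _,_ refl (sym (trans (cong (εʷ i v +_) (0∸n≡0 (φʷ i v))) (+-identityʳ _)))
signature-++ i (x ∷ u) v = begin
  signature i (x ∷ u ++ v)                                 ≡⟨ signature-∷ (letter i x) (u ++ v) ⟩
  act (letter i x) (signature i (u ++ v))                  ≡⟨ cong (act (letter i x)) (signature-++ i u v) ⟩
  act (letter i x) (signature i u ⊗ signature i v)         ≡⟨ act-⊗ (letter i x) (signature i u) (signature i v) ⟩
  act (letter i x) (signature i u) ⊗ signature i v         ≡⟨ cong (_⊗ signature i v) (sym (signature-∷ (letter i x) u)) ⟩
  signature i (x ∷ u) ⊗ signature i v                      ∎
  where open ≡-Reasoning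

φ-++ : ∀ i u v → φʷ i (u ++ v) ≡ φʷ i u + (φʷ i v ∸ εʷ i u)
φ-++ i u v = cong proj₁ (signature-++ i u v)

ε-++ : ∀ i u v → εʷ i (u ++ v) ≡ εʷ i v + (εʷ i u ∸ φʷ i v)
ε-++ i u v = cong proj₂ (signature-++ i u v)

infix 4 _↝_ _≈_

-- Knuth moves
data _↝_ : Rel Word 0ℓ where
  left  : ∀ {x y z w} → x ≤ y → y < z → (x ∷ z ∷ y ∷ w) ↝ (z ∷ x ∷ y ∷ w)
  right : ∀ {x y z w} → x < y → y ≤ z → (y ∷ x ∷ z ∷ w) ↝ (y ∷ z ∷ x ∷ w)
  _∷_   : ∀ x {w v} → w ↝ v → (x ∷ w) ↝ (x ∷ v)

_≈_ : Rel Word 0ℓ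
_≈_ = EqClosure _↝_

-- Only a letter `i` and a letter `i+1` can fail to commute, and `x < z` makes them `x = i` and
-- `z = i+1`. Then `y = i` acts first and supplies a partner for `z`, whichever of `x` and `z` comes
-- next.
act-left : ∀ {i x y z} (k : Letter i x) (l : Letter i y) (m : Letter i z) → x ≤ y → y < z → ∀ s →
           act k (act m (act l s)) ≡ act m (act k (act l s))
act-left (other _ _) _           _           _ _ _ = refl
act-left low         _           (other _ _) _ _ _ = refl
act-left high        _           (other _ _) _ _ _ = refl
act-left low         low         high        _ _ _ = refl
act-left low         high        high        _ q _ = ⊥-elim (<-irrefl refl q)
act-left low         (other f _) high        p q _ = ⊥-elim (f (≤-antisym (s≤s⁻¹ q) p))
act-left low         _           low         p q _ = ⊥-elim (<⇒≱ q p)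
act-left high        _           low         p q _ = ⊥-elim (<⇒≱ q (≤-trans (n≤1+n _) p))
act-left high        _           high        p q _ = ⊥-elim (<⇒≱ q p)

-- The critical case is again `x = i`, `z = i+1`, now with `y = i+1` acting last. On φ = 0 one order
-- of `x` and `z` leaves an additional `i` and `i+1`, while the other lets them cancel; `y` cancels
-- the `i` in the first case and stays undeleted in the second.
act-right : ∀ {i x y z} (k : Letter i x) (l : Letter i y) (m : Letter i z) → x < y → y ≤ z → ∀ s →
            act l (act k (act m s)) ≡ act l (act m (act k s))
act-right (other _ _) _           _           _ _ _           = refl
act-right low         _           (other _ _) _ _ _           = refl
act-right high        _           (other _ _) _ _ _           = refl
act-right low         low         high        p _ _           = ⊥-elim (<-irrefl refl p)
act-right low         high        high        _ _ (zero  , _) = refl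
act-right low         high        high        _ _ (suc _ , _) = refl
act-right low         (other _ f) high        p q _           = ⊥-elim (f (≤-antisym q p))
act-right low         _           low         p q _           = ⊥-elim (<⇒≱ p q)
act-right high        _           low         p q _           = ⊥-elim (<⇒≱ p (≤-trans q (n≤1+n _)))
act-right high        _           high        p q _           = ⊥-elim (<⇒≱ p q)

signature-↝ : ∀ i {w v} → w ↝ v → signature i w ≡ signature i v
signature-↝ i (left {x} {y} {z} {w} p q) = begin
  signature i (x ∷ z ∷ y ∷ w)              ≡⟨ signature-∷₃ i x z y w ⟩
  act k (act m (act l (signature i w)))    ≡⟨ act-left k l m p q (signature i w) ⟩
  act m (act k (act l (signature i w)))    ≡⟨ sym (signature-∷₃ i z x y w) ⟩
  signature i (z ∷ x ∷ y ∷ w)              ∎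
  where
  open ≡-Reasoning
  k = letter i x
  l = letter i y
  m = letter i z
signature-↝ i (right {x} {y} {z} {w} p q) = begin
  signature i (y ∷ x ∷ z ∷ w)              ≡⟨ signature-∷₃ i y x z w ⟩
  act l (act k (act m (signature i w)))    ≡⟨ act-right k l m p q (signature i w) ⟩
  act l (act m (act k (signature i w)))    ≡⟨ sym (signature-∷₃ i y z x w) ⟩
  signature i (y ∷ z ∷ x ∷ w)              ∎
  where
  open ≡-Reasoning
  k = letter i x
  l = letter i y
  m = letter i z
signature-↝ i (_∷_ x {w} {v} r) = signature-∷-cong i x w v (signature-↝ i r)

signature-≈ : ∀ i {w v} → w ≈ v → signature i w ≡ signature i v
signature-≈ i = Eq.gfold isEquivalence (signature i) (signature-↝ i)

-- Letter changes and Knuth moves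

φ-below : ∀ {i x} w → x < i → φʷ i (x ∷ w) ≡ φʷ i w
φ-below w p = φ-other w (<⇒≢ p) (<⇒≢ (m<n⇒m<1+n p))

φ-above : ∀ {i x} w → suc i < x → φʷ i (x ∷ w) ≡ φʷ i w
φ-above {i} w p = φ-other w (>⇒≢ (<-trans (n<1+n i) p)) (>⇒≢ p)

φ≡0⇒≢low : ∀ {i x} w → φʷ i (x ∷ w) ≡ 0 → x ≢ i
φ≡0⇒≢low {i} w e refl = 1+n≢0 (trans (sym (φ-low i w)) e)

ε≡0⇒≢high : ∀ {i x} w → φʷ i w ≡ 0 → εʷ i (x ∷ w) ≡ 0 → x ≢ suc i
ε≡0⇒≢high {i} w z e refl = 1+n≢0 (trans (sym (ε-high₀ i w z)) e)

≢high⇒ε : ∀ {i x} w → x ≢ suc i → εʷ i (x ∷ w) ≡ εʷ i w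
≢high⇒ε {i} {x} w f with letter i x
... | low       = ε-low i w
... | high      = ⊥-elim (f refl)
... | other p q = ε-other w p q

high-low : ∀ i w → φʷ i (suc i ∷ i ∷ w) ≡ φʷ i w
high-low i w = trans (φ-high i (i ∷ w)) (cong pred (φ-low i w))

ε-high-low : ∀ i → εʷ i (suc i ∷ i ∷ []) ≡ 0
ε-high-low i = trans (ε-high₊ i (i ∷ []) (λ z → 1+n≢0 (trans (sym (φ-low i [])) z))) (ε-low i [])

strictly : ∀ {m n} → m ≤ n → n ≢ m → m < n
strictly p f = ≤∧≢⇒< p (f ∘ sym)

SplitUpTo : ℕ → ℕ → ℕ → Word → Word → Set
SplitUpTo i x y v w' = ∃[ v' ] Split i x y v v' × w' ≈ v'

-- As ε vanishes on `u`, nothing cancels between `u` and `a ∷ s`, so φ is additive there. Since φ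
-- vanishes on `s`, the summand of `a ∷ s` depends on `a` alone, and φ of the whole word determines
-- φ of the prefix.
φ-prefix : ∀ i a u s u' s' → signature i (u ++ a ∷ s) ≡ signature i (u' ++ a ∷ s') →
           φʷ i s ≡ 0 → φʷ i s' ≡ 0 → εʷ i u ≡ 0 → εʷ i u' ≡ 0 → φʷ i u ≡ φʷ i u'
φ-prefix i a u s u' s' e z z' f f' = +-cancelʳ-≡ (φʷ i (a ∷ s)) _ _ (begin
  φʷ i u + φʷ i (a ∷ s)                 ≡⟨ cong (λ k → φʷ i u + (φʷ i (a ∷ s) ∸ k)) (sym f) ⟩
  φʷ i u + (φʷ i (a ∷ s) ∸ εʷ i u)      ≡⟨ sym (φ-++ i u (a ∷ s)) ⟩
  φʷ i (u ++ a ∷ s)                     ≡⟨ cong proj₁ e ⟩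
  φʷ i (u' ++ a ∷ s')                   ≡⟨ φ-++ i u' (a ∷ s') ⟩
  φʷ i u' + (φʷ i (a ∷ s') ∸ εʷ i u')   ≡⟨ cong₂ (λ k l → φʷ i u' + (k ∸ l)) (φ-∷-cong i a s' s (trans z' (sym z))) f' ⟩
  φʷ i u' + φʷ i (a ∷ s)                ∎)
  where open ≡-Reasoning

-- If `x` itself changes, the Knuth move lies behind it. Otherwise ε must vanish on the new prefix
-- with `x` in front; this depends on φ of that prefix too, because a letter `i+1` needs an `i` to
-- cancel, and `φ-prefix` supplies the equality.
split-∷ : ∀ {i a b} x {w v w'} → w ↝ v → (∀ {u'} → Split i a b w u' → SplitUpTo i a b v u') →
          Split i a b (x ∷ w) w' → SplitUpTo i a b (x ∷ v) w'
split-∷ {i} x {v = v} r h (split [] s refl refl e f) =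
  _ , split [] v refl refl (trans (sym (cong proj₁ (signature-↝ i r))) e) refl , Eq.return (_ ∷ r)
split-∷ {i} {a} x r h (split (_ ∷ u) s refl refl e f)
  with v' , split u' s' refl refl e' f' , r' ← h (split u s refl refl e (ε-∷ i x u f)) =
  _ , split (x ∷ u') s' refl refl e'
        (trans (sym (cong proj₂ (signature-∷-cong i x u u' (cong₂ _,_
          (φ-prefix i a u s u' s' (signature-↝ i r) e e' (ε-∷ i x u f) f') (trans (ε-∷ i x u f) (sym f')))))) f) ,
  Eq.gmap (x ∷_) (x ∷_) r'

-- The letter is changed in front of, inside or behind the three letters of a Knuth
-- move; inside, the changed words are again related by a Knuth move, possibly of the
-- other kind and in the opposite direction.
F-↝ : ∀ {i w v w'} → w ↝ v → Split i i (suc i) w w' → SplitUpTo i i (suc i) v w'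
F-↝ {i} (left {y = y} {z} {w} p q) (split [] _ refl refl e f) with m≤n⇒m<n∨m≡n p
... | inj₁ y> = _ , split (z ∷ []) (y ∷ w) refl refl (trans (sym (φ-above (y ∷ w) z>)) e) (≢high⇒ε [] (>⇒≢ z>)) ,
                Eq.return (left y> q)
  where
  z> = ≤-<-trans y> q
... | inj₂ refl with m≤n⇒m<n∨m≡n q
...   | inj₁ z>   = ⊥-elim (φ≡0⇒≢low {i} w (trans (sym (φ-above (i ∷ w) z>)) e) refl)
-- Here `i (i+1) i` becomes `(i+1) (i+1) i`, but in `(i+1) i i` the last letter changes, giving
-- `(i+1) i (i+1)`. A `left` move turns into a reversed `right` move.
...   | inj₂ refl = _ , split (suc i ∷ i ∷ []) w refl refl (trans (sym (high-low i w)) e) (ε-high-low i) ,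
                    Eq.symmetric _ (Eq.return (right (n<1+n i) ≤-refl))
F-↝ {i} (left {x} {y} {w = w} p q) (split (_ ∷ []) _ refl refl e f) =
  _ , split [] (x ∷ y ∷ w) refl refl (trans (φ-below (y ∷ w) (≤-<-trans p q)) e) refl ,
  Eq.return (left p (m<n⇒m<1+n q))
F-↝ {i} (left {x} {z = z} {w} p q) (split (_ ∷ _ ∷ []) _ refl refl e f) =
  _ , split (z ∷ x ∷ []) w refl refl e
        (trans (≢high⇒ε (x ∷ []) z≢) (≢high⇒ε [] (<⇒≢ (s≤s p)))) ,
  Eq.return (left (≤-trans p (n≤1+n i)) (strictly q z≢))
  where
  z≢ = ε≡0⇒≢high [] refl (ε-∷ i x (z ∷ []) f)
F-↝ {i} (left p q) (split (_ ∷ _ ∷ _ ∷ u) s refl refl e f) =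
  _ , split (_ ∷ _ ∷ _ ∷ u) s refl refl e (trans (sym (cong proj₂ (signature-↝ i (left {w = u} p q)))) f) ,
  Eq.return (left p q)
F-↝ {i} (right {x} {z = z} {w} p q) (split [] _ refl refl e f) =
  _ , split [] (z ∷ x ∷ w) refl refl (trans (trans (φ-∷-cong i z (x ∷ w) w (φ-below w p)) (sym (φ-below (z ∷ w) p))) e) refl ,
  Eq.return (right (m<n⇒m<1+n p) (strictly q (φ≡0⇒≢low w (trans (sym (φ-below (z ∷ w) p)) e))))
F-↝ {i} (right {y = y} {z} {w} p q) (split (_ ∷ []) _ refl refl e f) =
  _ , split (y ∷ z ∷ []) w refl refl (trans (sym (φ-above w z>)) e)
        (trans (≢high⇒ε (z ∷ []) (>⇒≢ y>)) (≢high⇒ε [] (>⇒≢ z>))) ,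
  Eq.return (right y> q)
  where
  y> = strictly p (ε≡0⇒≢high [] refl f)
  z> = <-≤-trans y> q
F-↝ {i} (right {x} {y} {w = w} p q) (split (_ ∷ _ ∷ []) _ refl refl e f) =
  _ , split (y ∷ []) (x ∷ w) refl refl (trans (φ-below w (<-≤-trans p q)) e) (≢high⇒ε [] (<⇒≢ (s≤s q))) ,
  Eq.return (right p (m≤n⇒m≤1+n q))
F-↝ {i} (right p q) (split (_ ∷ _ ∷ _ ∷ u) s refl refl e f) =
  _ , split (_ ∷ _ ∷ _ ∷ u) s refl refl e (trans (sym (cong proj₂ (signature-↝ i (right {w = u} p q)))) f) ,
  Eq.return (right p q)
F-↝ (x ∷ r) = split-∷ x r (F-↝ r)

E-↝ : ∀ {i w v w'} → w ↝ v → Split i (suc i) i w w' → SplitUpTo i (suc i) i v w'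
E-↝ {i} (left {y = y} {z} {w} p q) (split [] _ refl refl e f) =
  _ , split (z ∷ []) (y ∷ w) refl refl (trans (sym (φ-above (y ∷ w) z>)) e) (≢high⇒ε [] (>⇒≢ z>)) ,
  Eq.return (left (≤-trans (n≤1+n i) p) q)
  where
  z> = ≤-<-trans p q
E-↝ {i} (left {x} {y} {w = w} p q) (split (_ ∷ []) _ refl refl e f) =
  _ , split [] (x ∷ y ∷ w) refl refl (trans (φ-below (y ∷ w) (≤-<-trans p y<)) e) refl ,
  Eq.return (left p y<)
  where
  y< = ≤∧≢⇒< (s≤s⁻¹ q) (φ≡0⇒≢low w e)
E-↝ {i} (left {x} {z = z} {w} p q) (split (_ ∷ _ ∷ []) _ refl refl e f) =
  _ , split (z ∷ x ∷ []) w refl refl e (trans (≢high⇒ε (x ∷ []) (>⇒≢ q)) (≢high⇒ε [] x≢)) ,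
  Eq.return (left (s≤s⁻¹ (≤∧≢⇒< p x≢)) (<-trans (n<1+n i) q))
  where
  x≢ = ε≡0⇒≢high (z ∷ []) (φ-above [] q) f
E-↝ {i} (left p q) (split (_ ∷ _ ∷ _ ∷ u) s refl refl e f) =
  _ , split (_ ∷ _ ∷ _ ∷ u) s refl refl e (trans (sym (cong proj₂ (signature-↝ i (left {w = u} p q)))) f) ,
  Eq.return (left p q)
E-↝ {i} (right {x} {z = z} {w} p q) (split [] _ refl refl e f) =
  _ , split [] (z ∷ x ∷ w) refl refl (trans (trans (φ-∷-cong i z (x ∷ w) w (φ-below w x<)) (sym (φ-below (z ∷ w) x<))) e) refl ,
  Eq.return (right x< (≤-trans (n≤1+n i) q))
  where
  x< = ≤∧≢⇒< (s≤s⁻¹ p) (φ≡0⇒≢low (z ∷ w) e)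
E-↝ {i} (right {y = y} {z} {w} p q) (split (_ ∷ []) _ refl refl e f) =
  _ , split (y ∷ z ∷ []) w refl refl (trans (sym (φ-above w z>)) e)
        (trans (≢high⇒ε (z ∷ []) (>⇒≢ p)) (≢high⇒ε [] (>⇒≢ z>))) ,
  Eq.return (right (<-trans (n<1+n i) p) q)
  where
  z> = <-≤-trans p q
E-↝ {i} (right {x} {y} {w = w} p q) (split (_ ∷ _ ∷ []) _ refl refl e f) with m≤n⇒m<n∨m≡n q
... | inj₁ y< =
  _ , split (y ∷ []) (x ∷ w) refl refl (trans (φ-below w (<-≤-trans p (s≤s⁻¹ y<))) e) (≢high⇒ε [] (<⇒≢ y<)) ,
  Eq.return (right p (s≤s⁻¹ y<))
... | inj₂ refl with m≤n⇒m<n∨m≡n (s≤s⁻¹ p)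
...   | inj₁ x<   = ⊥-elim (ε≡0⇒≢high (x ∷ []) (φ-below [] x<) f refl)
-- The inverse situation: `(i+1) i (i+1)` becomes `(i+1) i i` and `(i+1) (i+1) i` becomes
-- `i (i+1) i`, so a `right` move turns into a reversed `left` move.
...   | inj₂ refl = _ , split [] (suc i ∷ i ∷ w) refl refl (trans (high-low i w) e) refl ,
                    Eq.symmetric _ (Eq.return (left ≤-refl (n<1+n i)))
E-↝ {i} (right p q) (split (_ ∷ _ ∷ _ ∷ u) s refl refl e f) =
  _ , split (_ ∷ _ ∷ _ ∷ u) s refl refl e (trans (sym (cong proj₂ (signature-↝ i (right {w = u} p q)))) f) ,
  Eq.return (right p q)
E-↝ (x ∷ r) = split-∷ x r (E-↝ r)

-- Row insertion and Knuth equivalence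
rowAfter : List ℕ → Word → List ℕ
rowAfter = foldl (flip newRow)

-- The lower rows see only the word of letters bumped out of the first row. This reduces the
-- invariance of `P` under Knuth moves to a single row and its output.
insertAll-row : ∀ r rs w → insertAll (r ∷ rs) w ≡ rowAfter r w ∷ insertAll rs (output r w)
insertAll-row r rs []      = refl
insertAll-row r rs (x ∷ w) with bumped x r
... | nothing = insertAll-row (newRow x r) rs w
... | just y  = insertAll-row (newRow x r) (insert y rs) w

P-row : ∀ x w → P (x ∷ w) ≡ rowAfter [] (x ∷ w) ∷ P (output [] (x ∷ w))
P-row x w = insertAll-row (x ∷ []) [] w

-- This and `pass` give the two cases of `rowInsert` as equations, so that `rewrite` can evaluate
-- chains of insertions from known inequalities.
bump : ∀ {x a} r → x < a → rowInsert x (a ∷ r) ≡ (x ∷ r , just a)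
bump {x} {a} r p with x <? a
... | yes _ = refl
... | no f  = ⊥-elim (f p)

pass : ∀ {x a} r → a ≤ x → rowInsert x (a ∷ r) ≡ (a ∷ newRow x r , bumped x r)
pass {x} {a} r p with x <? a
... | yes q = ⊥-elim (<⇒≱ q p)
... | no _  = refl

weak-All : ∀ {a r} → Linked _≤_ (a ∷ r) → All (a ≤_) r
weak-All [-]     = []
weak-All (p ∷ l) = p ∷ All.map (≤-trans p) (weak-All l)

-- The insertion of `z` passes the place that `y` has taken, so whatever `z` bumps stood to the
-- right of what `y` bumped.
row-bumping : ∀ {y z q} r → Linked _≤_ r → y ≤ z → bumped z (newRow y r) ≡ just q →
              ∃[ p ] bumped y r ≡ just p × p ≤ q
row-bumping {y} {z} []      l h e rewrite pass {z} {y} [] h with () ← e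
row-bumping {y} {z} (a ∷ r) l h e with <-≤-connex y a
... | inj₁ p rewrite bump r p | pass r h = a , refl , bumped-All z r e (weak-All l)
... | inj₂ p rewrite pass r p | pass (newRow y r) (≤-trans p h) = row-bumping r (Linked.tail l) h e

?∷ʷ-≈ : ∀ m {w v} → w ≈ v → (m ?∷ʷ w) ≈ (m ?∷ʷ v)
?∷ʷ-≈ nothing  e = e
?∷ʷ-≈ (just x) e = Eq.gmap (x ∷_) (x ∷_) e

RowEquivalent : List ℕ → Rel Word 0ℓ
RowEquivalent r w v = rowAfter r w ≡ rowAfter r v × output r w ≈ output r v

rowAfter-++ : ∀ r u t → rowAfter r (u ++ t) ≡ rowAfter (rowAfter r u) t
rowAfter-++ r u t = foldl-++ (flip newRow) r u t

?∷ʷ-++ : ∀ m u t → (m ?∷ʷ u) ++ t ≡ (m ?∷ʷ (u ++ t))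
?∷ʷ-++ nothing  u t = refl
?∷ʷ-++ (just x) u t = refl

output-++ : ∀ r u t → output r (u ++ t) ≡ output r u ++ output (rowAfter r u) t
output-++ r []      t = refl
output-++ r (x ∷ u) t = trans (cong (bumped x r ?∷ʷ_) (output-++ (newRow x r) u t))
                              (sym (?∷ʷ-++ (bumped x r) (output (newRow x r) u) _))

↝-++ : ∀ {w v} t → w ↝ v → (w ++ t) ↝ (v ++ t)
↝-++ t (left p q)  = left p q
↝-++ t (right p q) = right p q
↝-++ t (x ∷ r)     = x ∷ ↝-++ t r

≈-++ʳ : ∀ {w v} t → w ≈ v → (w ++ t) ≈ (v ++ t)
≈-++ʳ t = Eq.gmap (_++ t) (↝-++ t)

≈-++ˡ : ∀ u {w v} → w ≈ v → (u ++ w) ≈ (u ++ v)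
≈-++ˡ []      e = e
≈-++ˡ (x ∷ u) e = Eq.gmap (x ∷_) (x ∷_) (≈-++ˡ u e)

≡⇒≈ : ∀ {w v} → w ≡ v → w ≈ v
≡⇒≈ refl = Eq.reflexive _

rowEquivalent-++ : ∀ r u v t → RowEquivalent r u v → RowEquivalent r (u ++ t) (v ++ t)
rowEquivalent-++ r u v t (e , f) =
  trans (rowAfter-++ r u t) (trans (cong (λ s → rowAfter s t) e) (sym (rowAfter-++ r v t))) ,
  subst₂ _≈_ (sym (output-++ r u t))
    (trans (cong (λ s → output r v ++ output s t) e) (sym (output-++ r v t)))
    (≈-++ʳ (output (rowAfter r u) t) f)

-- If `a ≤ x`, all three letters pass `a` and the claim descends to the rest of the row. Otherwise
-- `x` bumps something at the head, and the comparison of `z` with `a` decides which Knuth move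
-- relates the outputs.
left-row : ∀ {x y z} r → Linked _≤_ r → x ≤ y → y < z →
           RowEquivalent r (x ∷ z ∷ y ∷ []) (z ∷ x ∷ y ∷ [])
left-row {x} {y} {z} [] l h k
  rewrite pass [] (≤-trans h (<⇒≤ k)) | pass (z ∷ []) h | bump [] k | bump [] (≤-<-trans h k) | pass [] h =
  refl , Eq.reflexive _
left-row {x} {y} {z} (a ∷ r) l h k with <-≤-connex x a | <-≤-connex z a
... | inj₂ p | _
  rewrite pass r p | pass (newRow x r) (≤-trans p (≤-trans h (<⇒≤ k))) | pass (newRow z (newRow x r)) (≤-trans p h)
        | pass r (≤-trans p (≤-trans h (<⇒≤ k))) | pass (newRow z r) p | pass (newRow x (newRow z r)) (≤-trans p h) =
  cong (a ∷_) (proj₁ ih) , proj₂ ih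
  where ih = left-row r (Linked.tail l) h k
... | inj₁ p | inj₂ q
  rewrite bump r p | pass r (≤-trans h (<⇒≤ k)) | pass (newRow z r) h
        | pass r q | bump (newRow z r) p | pass (newRow z r) h = refl , outputs
  where
  outputs : (a ∷ (bumped z r ?∷ʷ (bumped y (newRow z r) ?∷ʷ []))) ≈
            (bumped z r ?∷ʷ (a ∷ (bumped y (newRow z r) ?∷ʷ [])))
  outputs with bumped z r in e
  ... | nothing = Eq.reflexive _
  -- Since `z` now lies in the row, `y < z` bumps some `c ≤ z`. So `a ≤ c < b`, and `a b c` and
  -- `b a c` differ by a `left` move.
  ... | just b with c , f , c≤z ← bumped-≤ y (newRow z r) (newRow-weak z r (Linked.tail l)) (∈-newRow z r) k
    rewrite f = Eq.return (left (bumped-All y (newRow z r) f (newRow-All z r q (weak-All l)))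
                                (≤-<-trans c≤z (bumped-> z r e)))
left-row {x} {y} {z} (a ∷ []) l h k | inj₁ p | inj₁ q
  rewrite bump [] p | pass [] (≤-trans h (<⇒≤ k)) | pass (z ∷ []) h | bump [] k
        | bump [] q | bump [] (≤-<-trans h k) | pass [] h = refl , Eq.reflexive _
-- All insertions happen in the first two cells. The outputs are `a b z` and `a z b` with
-- `z < a ≤ b`, so the kind of the move changes.
left-row {x} {y} {z} (a ∷ b ∷ r) (a≤b ∷ l) h k | inj₁ p | inj₁ q
  rewrite bump (b ∷ r) p | pass (b ∷ r) (≤-trans h (<⇒≤ k)) | bump r (<-≤-trans q a≤b) | pass (z ∷ r) h | bump r k
        | bump (b ∷ r) q | bump (b ∷ r) (≤-<-trans h k) | pass (b ∷ r) h | bump r (<-≤-trans (<-trans k q) a≤b) =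
  refl , Eq.symmetric _ (Eq.return (right q a≤b))

-- The cases are those of `left-row` with `y` in place of `z`; the outputs agree or differ by a
-- `right` move, unless the claim descends past `a`.
right-row : ∀ {x y z} r → Linked _≤_ r → x < y → y ≤ z →
            RowEquivalent r (y ∷ x ∷ z ∷ []) (y ∷ z ∷ x ∷ [])
right-row {x} {y} {z} [] l h k
  rewrite bump [] h | pass [] (≤-trans (<⇒≤ h) k) | pass [] k | bump (z ∷ []) h = refl , Eq.reflexive _
right-row {x} {y} {z} (a ∷ r) l h k with <-≤-connex x a | <-≤-connex y a
... | inj₂ p | _
  rewrite pass r (≤-trans p (<⇒≤ h)) | pass (newRow y r) p | pass (newRow x (newRow y r)) (≤-trans p (≤-trans (<⇒≤ h) k))
        | pass (newRow y r) (≤-trans p (≤-trans (<⇒≤ h) k)) | pass (newRow z (newRow y r)) p =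
  cong (a ∷_) (proj₁ ih) , proj₂ ih
  where ih = right-row r (Linked.tail l) h k
... | inj₁ p | inj₂ q
  rewrite pass r q | bump (newRow y r) p | pass (newRow y r) (≤-trans (<⇒≤ h) k)
        | pass (newRow y r) (≤-trans q k) | bump (newRow z (newRow y r)) p = refl , outputs
  where
  outputs : (bumped y r ?∷ʷ (a ∷ (bumped z (newRow y r) ?∷ʷ []))) ≈
            (bumped y r ?∷ʷ (bumped z (newRow y r) ?∷ʷ (a ∷ [])))
  outputs with bumped z (newRow y r) in e
  ... | nothing = Eq.reflexive _
  -- If the second of `y` and `z` bumps `c`, the first has bumped some `b ≤ c`, whence
  -- `a ≤ y < b ≤ c`.
  ... | just c with b , f , b≤c ← row-bumping r (Linked.tail l) k e
    rewrite f = Eq.return (right (≤-<-trans q (bumped-> y r f)) b≤c)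
... | inj₁ p | inj₁ q
  rewrite bump r q | bump r h | pass r (≤-trans (<⇒≤ h) k) | pass r k | bump (newRow z r) h = refl , outputs
  where
  outputs : (a ∷ y ∷ (bumped z r ?∷ʷ [])) ≈ (a ∷ (bumped z r ?∷ʷ (y ∷ [])))
  outputs with bumped z r in e
  ... | nothing = Eq.reflexive _
  ... | just c  = Eq.return (right q (bumped-All z r e (weak-All l)))

↝-row : ∀ {r w v} → Linked _≤_ r → w ↝ v → RowEquivalent r w v
↝-row {r} l (left {x} {y} {z} {t} p q)  =
  rowEquivalent-++ r (x ∷ z ∷ y ∷ []) (z ∷ x ∷ y ∷ []) t (left-row r l p q)
↝-row {r} l (right {x} {y} {z} {t} p q) =
  rowEquivalent-++ r (y ∷ x ∷ z ∷ []) (y ∷ z ∷ x ∷ []) t (right-row r l p q)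
↝-row {r} l (x ∷ s) with e , f ← ↝-row (newRow-weak x r l) s = e , ?∷ʷ-≈ (bumped x r) f

≈-row : ∀ {r w v} → Linked _≤_ r → w ≈ v → RowEquivalent r w v
≈-row {r} l = Eq.fold equivalence (↝-row l)
  where
  equivalence : IsEquivalence (RowEquivalent r)
  equivalence = record
    { refl  = refl , Eq.reflexive _
    ; sym   = λ (e , f) → sym e , Eq.symmetric _ f
    ; trans = λ (e , f) (e' , f') → trans e e' , Eq.transitive _ f f'
    }

?∷ʷ-length : ∀ m w → length (m ?∷ʷ w) ≤ suc (length w)
?∷ʷ-length nothing  w = n≤1+n _
?∷ʷ-length (just x) w = ≤-refl

output-length : ∀ r w → length (output r w) ≤ length w
output-length r []      = z≤n
output-length r (x ∷ w) = ≤-trans (?∷ʷ-length (bumped x r) (output (newRow x r) w))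
                                  (s≤s (output-length (newRow x r) w))

length-↝ : ∀ {w v} → w ↝ v → length w ≡ length v
length-↝ (left _ _)  = refl
length-↝ (right _ _) = refl
length-↝ (x ∷ r)     = cong suc (length-↝ r)

length-≈ : ∀ {w v} → w ≈ v → length w ≡ length v
length-≈ = Eq.gfold isEquivalence length length-↝

-- Equivalent words leave the same first row and bump out equivalent, shorter words.
P-≈ : ∀ {w v} → w ≈ v → P w ≡ P v
P-≈ e = go _ ≤-refl e
  where
  go : ∀ k {w v} → length w ≤ k → w ≈ v → P w ≡ P v
  go k       {[]}    {[]}    _       e = refl
  go k       {[]}    {y ∷ v} _       e with () ← length-≈ e
  go k       {x ∷ w} {[]}    _       e with () ← length-≈ e
  go (suc k) {x ∷ w} {y ∷ v} (s≤s b) e with f , g ← ≈-row [] e =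
    trans (P-row x w) (trans (cong₂ _∷_ f (go k (≤-trans (output-length (x ∷ []) w) b) g)) (sym (P-row y v)))

-- Readings of a tableau and its reconstruction by `P`

rowReading : Rows → Word
rowReading []       = []
rowReading (r ∷ rs) = rowReading rs ++ r

newRow-append : ∀ x r → bumped x r ≡ nothing → newRow x r ≡ r ++ x ∷ []
newRow-append x []      e = refl
newRow-append x (a ∷ r) e with x <? a
... | no _ = cong (a ∷_) (newRow-append x r e)

-- The letter `x` travels left through `r` by `right` moves; each needs the entry before the pair,
-- which exceeds `x` and is at most the entry being crossed.
pull : ∀ {x a r} → Linked _≤_ (a ∷ r) → x < a → (a ∷ r ++ x ∷ []) ≈ (a ∷ x ∷ r)
pull {r = []}            l       p = Eq.reflexive _
pull {a = a} {r = b ∷ r} (q ∷ l) p = Eq.transitive _ (Eq.gmap (a ∷_) (a ∷_) (pull l (<-≤-trans p q)))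
                                 (Eq.symmetric _ (Eq.return (right p q)))

-- The new head `z` is the third letter of the `left` move that carries the bumped letter `y` over
-- `a`.
newRow-head : ∀ {a x y} r → Linked _≤_ (a ∷ r) → a ≤ x → bumped x r ≡ just y →
              ∃[ z ] ∃[ s ] newRow x r ≡ z ∷ s × a ≤ z × z < y
newRow-head {a} {x} (b ∷ r) l p e with x <? b
newRow-head {a} {x} (b ∷ r) l p refl    | yes q = x , r , refl , p , q
newRow-head {a} {x} (b ∷ r) (q ∷ l) p e | no f  = b , newRow x r , refl , q , ≤-<-trans (≮⇒≥ f) (bumped-> x r e)

-- From right to left: `x` first moves to its place by `pull`, right behind the letter it bumps, and
-- that letter then moves to the front by `left` moves.
row-≈ : ∀ {x y} r → Linked _≤_ r → bumped x r ≡ just y → (y ∷ newRow x r) ≈ (r ++ x ∷ [])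
row-≈ {x} {y} (a ∷ r) l e with <-≤-connex x a
... | inj₁ p rewrite bump r p with refl ← e = Eq.symmetric _ (pull l p)
... | inj₂ p rewrite pass r p with newRow-head r l p e | row-≈ r (Linked.tail l) e
...   | z , s , f , a≤z , z<y | ih =
  Eq.transitive _ {y ∷ a ∷ newRow x r} {a ∷ y ∷ newRow x r}
    (subst (λ t → (y ∷ a ∷ t) ≈ (a ∷ y ∷ t)) (sym f) (Eq.symmetric _ (Eq.return (left a≤z z<y))))
    (Eq.gmap (a ∷_) (a ∷_) ih)

rowReading-insert : ∀ x T → All (Linked _≤_) T → rowReading (insert x T) ≈ (rowReading T ++ x ∷ [])
rowReading-insert x []       _       = Eq.reflexive _
rowReading-insert x (r ∷ rs) (l ∷ ls) with bumped x r in e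
... | nothing = ≡⇒≈ (trans (cong (rowReading rs ++_) (newRow-append x r e)) (sym (++-assoc (rowReading rs) r (x ∷ []))))
... | just y  = Eq.transitive _ (≈-++ʳ (newRow x r) (rowReading-insert y rs ls))
  (Eq.transitive _ (≡⇒≈ (++-assoc (rowReading rs) (y ∷ []) (newRow x r)))
    (Eq.transitive _ (≈-++ˡ (rowReading rs) (row-≈ r l e)) (≡⇒≈ (sym (++-assoc (rowReading rs) r (x ∷ []))))))

rowReading-P : ∀ w → rowReading (P w) ≈ w
rowReading-P w = go [] w []
  where
  go : ∀ T w → All (Linked _≤_) T → rowReading (insertAll T w) ≈ (rowReading T ++ w)
  go T []      l = ≡⇒≈ (sym (++-identityʳ (rowReading T)))
  go T (x ∷ w) l = Eq.transitive _ (go (insert x T) w (insert-weak x T l))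
    (Eq.transitive _ (≈-++ʳ w (rowReading-insert x T l)) (≡⇒≈ (++-assoc (rowReading T) (x ∷ []) w)))

append-row : ∀ {x} s → All (_≤ x) s → rowInsert x s ≡ (s ++ x ∷ [] , nothing)
append-row []      []       = refl
append-row (a ∷ s) (p ∷ ps) rewrite pass s p | append-row s ps = refl

replace-last : ∀ {x y} s → All (_≤ x) s → x < y → rowInsert x (s ++ y ∷ []) ≡ (s ++ x ∷ [] , just y)
replace-last []      []       q = bump [] q
replace-last {y = y} (a ∷ s) (p ∷ ps) q rewrite pass (s ++ y ∷ []) p | replace-last s ps q = refl

-- Read from the bottom, the lowest entry is appended to the row and every later entry replaces the
-- one before it. Only the top entry stays.
column-row : ∀ {x} s c → All (_≤ x) s → Linked _<_ (x ∷ c) →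
             rowAfter s (reverse (x ∷ c)) ≡ s ++ x ∷ [] × output s (reverse (x ∷ c)) ≡ reverse c
column-row {x} s []      p l rewrite append-row s p = refl , refl
column-row {x} s (y ∷ c) p (q ∷ l) with column-row s c (All.map (λ h → ≤-trans h (<⇒≤ q)) p) l
... | e , f rewrite unfold-reverse x (y ∷ c) =
  trans (rowAfter-++ s (reverse (y ∷ c)) (x ∷ []))
    (trans (cong (newRow x) e) (cong proj₁ (replace-last s p q))) ,
  trans (output-++ s (reverse (y ∷ c)) (x ∷ []))
    (trans (cong₂ _++_ f (trans (cong (λ r → bumped x r ?∷ʷ []) e)
       (cong (_?∷ʷ []) (cong proj₂ (replace-last s p q)))))
      (sym (unfold-reverse y c)))

-- Here `s` is the part of the first row built by the columns already read. Every further column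
-- appends its top entry and bumps out the others in their order, which leaves the column reading of
-- the rows below.
columns-row : ∀ s {r cs} → All (λ a → All (a ≤_) r) s → Linked _≤_ r → Prefix (λ c x → Linked _<_ (x ∷ c)) cs r →
              rowAfter s (reading (consRow r cs)) ≡ s ++ r × output s (reading (consRow r cs)) ≡ reading cs
columns-row s {[]}    p l []      = sym (++-identityʳ s) , refl
columns-row s {x ∷ r} p l q = go q
  where
  p' : All (λ a → All (a ≤_) r) (s ++ x ∷ [])
  p' = Allₚ.++⁺ (All.map All.tail p) (weak-All l ∷ [])
  after : ∀ {c cs} → Linked _<_ (x ∷ c) → Prefix (λ c x → Linked _<_ (x ∷ c)) cs r →
          rowAfter s (reverse (x ∷ c) ++ reading (consRow r cs)) ≡ s ++ x ∷ r ×
          output s (reverse (x ∷ c) ++ reading (consRow r cs)) ≡ reverse c ++ reading cs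
  after {c} {cs} h q with e , f ← column-row s c (All.map All.head p) h
                        | e' , f' ← columns-row (s ++ x ∷ []) p' (Linked.tail l) q =
    trans (rowAfter-++ s (reverse (x ∷ c)) _) (trans (cong (λ t → rowAfter t (reading (consRow r cs))) e)
      (trans e' (++-assoc s (x ∷ []) r))) ,
    trans (output-++ s (reverse (x ∷ c)) _) (cong₂ _++_ f (trans (cong (λ t → output t (reading (consRow r cs))) e) f'))
  go : ∀ {cs} → Prefix (λ c x → Linked _<_ (x ∷ c)) cs (x ∷ r) →
       rowAfter s (reading (consRow (x ∷ r) cs)) ≡ s ++ x ∷ r × output s (reading (consRow (x ∷ r) cs)) ≡ reading cs
  go []      = after [-] []
  go (h ∷ q) = after h q

P-nonempty-row : ∀ {x r} w → rowAfter [] w ≡ x ∷ r → P w ≡ (x ∷ r) ∷ P (output [] w)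
P-nonempty-row (y ∷ w) e = trans (P-row y w) (cong (_∷ P (output [] (y ∷ w))) e)

P-CR : ∀ {T} → All (λ r → 0 < length r) T → All (Linked _≤_) T → Linked (Under _<_) T → P (CR T) ≡ T
P-CR []       _        _ = refl
P-CR {(x ∷ r) ∷ T} (_ ∷ ps) (l ∷ ls) k with e , f ← columns-row [] [] l (transpose-fits k) =
  trans (P-nonempty-row (CR ((x ∷ r) ∷ T)) e)
        (cong ((x ∷ r) ∷_) (trans (cong P f) (P-CR ps ls (Linked.tail k))))

P-strict : ∀ w → Linked (Under _<_) (P w)
P-strict w = go [] w []
  where
  go : ∀ T w → Linked (Under _<_) T → Linked (Under _<_) (insertAll T w)
  go T []      l = l
  go T (x ∷ w) l = go (insert x T) w (insert-strict x T l)

P-weak : ∀ w → All (Linked _≤_) (P w)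
P-weak w = go [] w []
  where
  go : ∀ T w → All (Linked _≤_) T → All (Linked _≤_) (insertAll T w)
  go T []      l = l
  go T (x ∷ w) l = go (insert x T) w (insert-weak x T l)

-- For `T = P w` one has `P (CR T) = T`. Applying `rowReading-P` to both `CR T` and `w` shows that
-- the row reading of `T` is equivalent to each of them.
CR-P : ∀ w → CR (P w) ≈ w
CR-P w = Eq.transitive _ (Eq.symmetric _ (rowReading-P (CR (P w))))
  (Eq.transitive _ (≡⇒≈ (cong rowReading (P-CR (insertAll-nonempty [] w []) (P-weak w) (P-strict w)))) (rowReading-P w))

-- The operators on words
φ-split-low : ∀ i u v → εʷ i u ≡ 0 → φʷ i v ≡ 0 → φʷ i (u ++ i ∷ v) ≡ suc (φʷ i u)
φ-split-low i u v e f = begin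
  φʷ i (u ++ i ∷ v)                   ≡⟨ φ-++ i u (i ∷ v) ⟩
  φʷ i u + (φʷ i (i ∷ v) ∸ εʷ i u)    ≡⟨ cong₂ (λ k l → φʷ i u + (k ∸ l)) (trans (φ-low i v) (cong suc f)) e ⟩
  φʷ i u + 1                          ≡⟨ +-comm (φʷ i u) 1 ⟩
  suc (φʷ i u)                        ∎
  where open ≡-Reasoning

φ-split-high : ∀ i u v → εʷ i u ≡ 0 → φʷ i v ≡ 0 → φʷ i (u ++ suc i ∷ v) ≡ φʷ i u
φ-split-high i u v e f = begin
  φʷ i (u ++ suc i ∷ v)                   ≡⟨ φ-++ i u (suc i ∷ v) ⟩
  φʷ i u + (φʷ i (suc i ∷ v) ∸ εʷ i u)    ≡⟨ cong₂ (λ k l → φʷ i u + (k ∸ l)) (trans (φ-high i v) (cong pred f)) e ⟩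
  φʷ i u + 0                              ≡⟨ +-identityʳ _ ⟩
  φʷ i u                                  ∎
  where open ≡-Reasoning

ε-split-high : ∀ i u v → εʷ i u ≡ 0 → φʷ i v ≡ 0 → εʷ i (u ++ suc i ∷ v) ≢ 0
ε-split-high i u v e f z = 1+n≢0 (begin
  suc (εʷ i v)                                    ≡⟨ sym (ε-high₀ i v f) ⟩
  εʷ i (suc i ∷ v)                                ≡⟨ m+n≡0⇒m≡0 _ (trans (sym (ε-++ i u (suc i ∷ v))) z) ⟩
  0                                               ∎)
  where open ≡-Reasoning

-- At most one position of a word satisfies the conditions in Split.
no-inner : ∀ i {a} u t v → a ≡ i ⊎ a ≡ suc i → εʷ i (u ++ a ∷ t) ≡ 0 → φʷ i (t ++ a ∷ v) ≡ 0 → ⊥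
no-inner i (x ∷ u) t v h e f = no-inner i u t v h (ε-∷ i x (u ++ _ ∷ t) e) f
no-inner i [] t v (inj₁ refl) e f = 1+n≢0 (begin
  suc (φʷ i v)                                ≡⟨ sym (φ-low i v) ⟩
  φʷ i (i ∷ v)                                ≡⟨ cong (φʷ i (i ∷ v) ∸_) (sym (ε-∷ i i t e)) ⟩
  φʷ i (i ∷ v) ∸ εʷ i t                       ≡⟨ m+n≡0⇒n≡0 (φʷ i t) (trans (sym (φ-++ i t (i ∷ v))) f) ⟩
  0                                           ∎)
  where open ≡-Reasoning
no-inner i [] t v (inj₂ refl) e f =
  ε≡0⇒≢high t (m+n≡0⇒m≡0 (φʷ i t) (trans (sym (φ-++ i t (suc i ∷ v))) f)) e refl

split-unique : ∀ {i a b w w' w''} → a ≡ i ⊎ a ≡ suc i → Split i a b w w' → Split i a b w w'' → w' ≡ w''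
split-unique {i} {a} h (split u v refl refl e f) (split u' v' o refl e' f') with split-++ u (a ∷ v) u' o
... | inj₁ (t , refl , refl)          = ⊥-elim (no-inner i u' t v h f e')
... | inj₂ ([] , refl , refl)         = cong (_++ _ ∷ v) (sym (++-identityʳ u))
... | inj₂ (_ ∷ t , refl , refl)      = ⊥-elim (no-inner i u t v' h f' e)

split-sym : ∀ {i a b w w'} → Split i a b w w' → Split i b a w' w
split-sym (split u v o n e f) = split u v n o e f

F̃ʷ-nothing⁻ : ∀ i w → F̃ʷ i w ≡ nothing → φʷ i w ≡ 0
F̃ʷ-nothing⁻ i w = go (proj₁ (undeleted i w))
  where
  go : ∀ as → Maybe.map (λ k → w [ k ]∷= suc i) (last as) ≡ nothing → length as ≡ 0
  go []           _ = refl
  go (_ ∷ b ∷ as) e with () ← go (b ∷ as) e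

F̃ʷ-nothing⁺ : ∀ i w → φʷ i w ≡ 0 → F̃ʷ i w ≡ nothing
F̃ʷ-nothing⁺ i w e with [] ← proj₁ (undeleted i w) = refl

Ẽʷ-nothing⁻ : ∀ i w → Ẽʷ i w ≡ nothing → εʷ i w ≡ 0
Ẽʷ-nothing⁻ i w e with [] ← proj₂ (undeleted i w) = refl

Ẽʷ-nothing⁺ : ∀ i w → εʷ i w ≡ 0 → Ẽʷ i w ≡ nothing
Ẽʷ-nothing⁺ i w e with [] ← proj₂ (undeleted i w) = refl

-- By uniqueness of the position, exhibiting any split computes the operator, without a look at the
-- list of undeleted positions.
F̃ʷ-just : ∀ {i w w'} → Split i i (suc i) w w' → F̃ʷ i w ≡ just w'
F̃ʷ-just {i} {w} s@(split u v refl _ e f) with F̃ʷ i w in eq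
... | just w'' = cong just (split-unique (inj₁ refl) (F̃ʷ-split i w eq) s)
... | nothing  = ⊥-elim (1+n≢0 (trans (sym (φ-split-low i u v f e)) (F̃ʷ-nothing⁻ i w eq)))

Ẽʷ-just : ∀ {i w w'} → Split i (suc i) i w w' → Ẽʷ i w ≡ just w'
Ẽʷ-just {i} {w} s@(split u v refl _ e f) with Ẽʷ i w in eq
... | just w'' = cong just (split-unique (inj₂ refl) (Ẽʷ-split i w eq) s)
... | nothing  = ⊥-elim (ε-split-high i u v f e (Ẽʷ-nothing⁻ i w eq))

-- Passing to `P` turns the equivalence of the changed words into an equation, which also covers the
-- value 0 and composes along chains of moves.
P-F̃ʷ-≈ : ∀ i {w v} → w ≈ v → Maybe.map P (F̃ʷ i w) ≡ Maybe.map P (F̃ʷ i v)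
P-F̃ʷ-≈ i = Eq.gfold isEquivalence (Maybe.map P ∘ F̃ʷ i) step
  where
  step : ∀ {w v} → w ↝ v → Maybe.map P (F̃ʷ i w) ≡ Maybe.map P (F̃ʷ i v)
  step {w} {v} r with F̃ʷ i w in eq
  ... | nothing = cong (Maybe.map P) (sym (F̃ʷ-nothing⁺ i v
                    (trans (sym (cong proj₁ (signature-↝ i r))) (F̃ʷ-nothing⁻ i w eq))))
  ... | just w' with v' , s , e ← F-↝ r (F̃ʷ-split i w eq) =
    trans (cong just (P-≈ e)) (cong (Maybe.map P) (sym (F̃ʷ-just s)))

P-Ẽʷ-≈ : ∀ i {w v} → w ≈ v → Maybe.map P (Ẽʷ i w) ≡ Maybe.map P (Ẽʷ i v)
P-Ẽʷ-≈ i = Eq.gfold isEquivalence (Maybe.map P ∘ Ẽʷ i) step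
  where
  step : ∀ {w v} → w ↝ v → Maybe.map P (Ẽʷ i w) ≡ Maybe.map P (Ẽʷ i v)
  step {w} {v} r with Ẽʷ i w in eq
  ... | nothing = cong (Maybe.map P) (sym (Ẽʷ-nothing⁺ i v
                    (trans (sym (cong proj₂ (signature-↝ i r))) (Ẽʷ-nothing⁻ i w eq))))
  ... | just w' with v' , s , e ← E-↝ r (Ẽʷ-split i w eq) =
    trans (cong just (P-≈ e)) (cong (Maybe.map P) (sym (Ẽʷ-just s)))

-- The AI-operator on words

even : ℕ → Bool
even k = does (2 ∣? k)

even-suc : ∀ k → even (suc k) ≡ not (even k)
even-suc zero          = refl
even-suc (suc zero)    = refl
-- `even (2 + k)` and `even k` agree by computation; this is used again wherever φ changes by 2.
even-suc (suc (suc k)) = even-suc k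

degree : Signature → ℕ
degree (a , b) = if even a then b else suc b

B̃ʷ : ℕ → Word → Maybe Word
B̃ʷ i w = if even (φʷ i w) then Ẽʷ i w else F̃ʷ i w

P-B̃ʷ-≈ : ∀ i {w v} → w ≈ v → Maybe.map P (B̃ʷ i w) ≡ Maybe.map P (B̃ʷ i v)
P-B̃ʷ-≈ i {w} {v} e with even (φʷ i w) | even (φʷ i v) | cong (even ∘ proj₁) (signature-≈ i e)
... | true  | _ | refl = P-Ẽʷ-≈ i e
... | false | _ | refl = P-F̃ʷ-≈ i e

-- φ w = φ u + 1 and φ w' = φ u, where u is the part in front of the changed letter,
-- so this says that φ w is odd.
record Paired (i : ℕ) (w w' : Word) : Set where
  constructor paired
  field
    raising     : Split i i (suc i) w w'
    even-prefix : even (φʷ i (Split.u raising)) ≡ true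

not-injective : ∀ {b} → not b ≡ false → b ≡ true
not-injective {true} _ = refl

even-pred : ∀ k → even (suc k) ≡ false → even k ≡ true
even-pred k e = not-injective (trans (sym (even-suc k)) e)

-- Where it is not 0, the operator is an involution: it raises a word with odd φ to one with even φ
-- and lowers that one back. So one relation, read in both directions, describes it.
B̃ʷ⇒paired : ∀ i w {w'} → B̃ʷ i w ≡ just w' → Paired i w w' ⊎ Paired i w' w
B̃ʷ⇒paired i w e with even (φʷ i w) in eq
... | false = inj₁ (paired s (even-pred (φʷ i (Split.u s)) (trans (cong even (sym (φs s))) eq)))
  where
  s = F̃ʷ-split i w e
  φs : ∀ {w'} (s : Split i i (suc i) w w') → φʷ i w ≡ suc (φʷ i (Split.u s))
  φs (split u v refl _ e f) = φ-split-low i u v f e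
... | true = inj₂ (paired (split-sym s) (trans (cong even (sym (φs s))) eq))
  where
  s = Ẽʷ-split i w e
  φs : ∀ {w'} (s : Split i (suc i) i w w') → φʷ i w ≡ φʷ i (Split.u s)
  φs (split u v refl _ e f) = φ-split-high i u v f e

B̃ʷ-raise : ∀ {i w w'} → Paired i w w' → B̃ʷ i w ≡ just w'
B̃ʷ-raise {i} {w} (paired s@(split u v refl _ e f) p) =
  trans (cong (λ b → if b then Ẽʷ i w else F̃ʷ i w)
          (trans (cong even (φ-split-low i u v f e)) (trans (even-suc (φʷ i u)) (cong not p))))
        (F̃ʷ-just s)

B̃ʷ-lower : ∀ {i w w'} → Paired i w w' → B̃ʷ i w' ≡ just w
B̃ʷ-lower {i} {w' = w'} (paired s@(split u v _ refl e f) p) =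
  trans (cong (λ b → if b then Ẽʷ i w' else F̃ʷ i w') (trans (cong even (φ-split-high i u v f e)) p))
        (Ẽʷ-just (split-sym s))

-- For odd φ there is a letter `i` to raise and the degree is positive. So the vanishing of the
-- operator can be read off the degree, which is what carries it over to `K₁ʷ`.
B̃ʷ-nothing⁻ : ∀ i w → B̃ʷ i w ≡ nothing → degree (signature i w) ≡ 0
B̃ʷ-nothing⁻ i w e with even (φʷ i w) in eq
... | true  = Ẽʷ-nothing⁻ i w e
... | false with () ← trans (sym eq) (cong even (F̃ʷ-nothing⁻ i w e))

B̃ʷ-nothing⁺ : ∀ i w → degree (signature i w) ≡ 0 → B̃ʷ i w ≡ nothing
B̃ʷ-nothing⁺ i w e with even (φʷ i w)
... | true = Ẽʷ-nothing⁺ i w e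

-- The complement of the first column
data ColumnSignature (i : ℕ) (C : List ℕ) : Signature → Set where
  none     : i ∉ C → suc i ∉ C → ColumnSignature i C (0 , 0)
  both     : i ∈ C → suc i ∈ C → ColumnSignature i C (0 , 0)
  onlyLow  : i ∈ C → suc i ∉ C → ColumnSignature i C (1 , 0)
  onlyHigh : i ∉ C → suc i ∈ C → ColumnSignature i C (0 , 1)

⊗-identityʳ : ∀ s → s ⊗ (0 , 0) ≡ s
⊗-identityʳ (a , b) = cong (_, b) (trans (cong (a +_) (0∸n≡0 b)) (+-identityʳ a))

signature-reverse-∷ : ∀ i {x} (l : Letter i x) c →
                      signature i (reverse (x ∷ c)) ≡ signature i (reverse c) ⊗ act l (0 , 0)
signature-reverse-∷ i {x} l c = trans (cong (signature i) (unfold-reverse x c))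
  (trans (signature-++ i (reverse c) (x ∷ [])) (cong (signature i (reverse c) ⊗_) (signature-∷ l [])))

columnSignature : ∀ i {C} → Linked _<_ C → ColumnSignature i C (signature i (reverse C))
columnSignature i {[]}    _ = none (λ ()) (λ ())
columnSignature i {x ∷ c} l =
  subst (ColumnSignature i (x ∷ c)) (sym (signature-reverse-∷ i (letter i x) c))
    (extend (letter i x) l (columnSignature i (Linked.tail l)))
  where
  extend : ∀ {x s} (k : Letter i x) → Linked _<_ (x ∷ c) → ColumnSignature i c s →
           ColumnSignature i (x ∷ c) (s ⊗ act k (0 , 0))
  extend low l (none f g)     = onlyLow (here refl) λ { (here e) → 1+n≢n e ; (there m) → g m }
  extend low l (both m _)     = ⊥-elim (<-irrefl refl (linked-< l m))
  extend low l (onlyLow m _)  = ⊥-elim (<-irrefl refl (linked-< l m))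
  extend low l (onlyHigh _ m) = both (here refl) (there m)
  extend high l (none f g)    = onlyHigh (λ { (here e) → 1+n≢n (sym e) ; (there m) → f m }) (here refl)
  extend high l (both _ m)    = ⊥-elim (<-irrefl refl (linked-< l m))
  extend high l (onlyLow m _) = ⊥-elim (<-asym (n<1+n i) (linked-< l m))
  extend high l (onlyHigh _ m) = ⊥-elim (<-irrefl refl (linked-< l m))
  extend {x} {s} (other p q) l k = subst (ColumnSignature i (x ∷ c)) (sym (⊗-identityʳ s)) (keep k)
    where
    skip : ∀ {z} → x ≢ z → z ∉ c → z ∉ x ∷ c
    skip f g (here e)  = f (sym e)
    skip f g (there m) = g m
    keep : ∀ {s} → ColumnSignature i c s → ColumnSignature i (x ∷ c) s
    keep (none f g)     = none (skip p f) (skip q g)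
    keep (both m m')    = both (there m) (there m')
    keep (onlyLow m g)  = onlyLow (there m) (skip q g)
    keep (onlyHigh f m) = onlyHigh (skip p f) (there m)

data Opposite : Signature → Signature → Set where
  neutral : Opposite (0 , 0) (0 , 0)
  lowHigh : Opposite (1 , 0) (0 , 1)
  highLow : Opposite (0 , 1) (1 , 0)

∈-complement⁺ : ∀ {n x C} → Bounded n x → x ∉ C → x ∈ complement n C
∈-complement⁺ {C = C} (s≤s z≤n , q) f = ∈-filter⁺ (λ x → ¬? (x ∈? C)) (∈-applyUpTo⁺ suc q) f

opposite : ∀ {n i C} → 1 ≤ i → i < n → Linked _<_ C →
           Opposite (signature i (reverse C)) (signature i (reverse (complement n C)))
opposite {n} {i} {C} 1≤i i<n l = go (columnSignature i l) (columnSignature i (complement-strict n C))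
  where
  K = complement n C
  in-i : i ∉ C → i ∈ K
  in-i = ∈-complement⁺ (1≤i , <⇒≤ i<n)
  in-si : suc i ∉ C → suc i ∈ K
  in-si = ∈-complement⁺ (s≤s z≤n , i<n)
  disjoint : ∀ {x} → x ∈ K → x ∉ C
  disjoint m = proj₂ (∈-filter⁻ (λ x → ¬? (x ∈? C)) {xs = applyUpTo suc n} m)
  go : ∀ {s t} → ColumnSignature i C s → ColumnSignature i K t → Opposite s t
  go (none _ _)     (none _ _)     = neutral
  go (none _ _)     (both _ _)     = neutral
  go (none _ g)     (onlyLow _ h)  = ⊥-elim (h (in-si g))
  go (none f _)     (onlyHigh h _) = ⊥-elim (h (in-i f))
  go (both _ _)     (none _ _)     = neutral
  go (both _ _)     (both _ _)     = neutral
  go (both m _)     (onlyLow k _)  = ⊥-elim (disjoint k m)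
  go (both _ m)     (onlyHigh _ k) = ⊥-elim (disjoint k m)
  go (onlyLow _ g)  (none _ h)     = ⊥-elim (h (in-si g))
  go (onlyLow m _)  (both k _)     = ⊥-elim (disjoint k m)
  go (onlyLow m _)  (onlyLow k _)  = ⊥-elim (disjoint k m)
  go (onlyLow _ _)  (onlyHigh _ _) = lowHigh
  go (onlyHigh f _) (none h _)     = ⊥-elim (h (in-i f))
  go (onlyHigh _ m) (both _ k)     = ⊥-elim (disjoint k m)
  go (onlyHigh _ _) (onlyLow _ _)  = highLow
  go (onlyHigh f _) (onlyHigh h _) = ⊥-elim (h (in-i f))

degree-opposite : ∀ {s s'} t → Opposite s s' → degree (s ⊗ t) ≡ degree (s' ⊗ t)
degree-opposite t           neutral = refl
degree-opposite (c , d)     lowHigh = lemma c d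
  where
  lemma : ∀ c d → degree ((1 , 0) ⊗ (c , d)) ≡ degree ((0 , 1) ⊗ (c , d))
  lemma zero    d = sym (+-suc d 0)
  lemma (suc c) d = cong (λ k → degree (c , d + k)) (sym (0∸n≡0 c))
degree-opposite t           highLow = sym (degree-opposite t lowHigh)

-- Let `c` be φ of the part behind the column. If `c = 0`, a column `(1 , 0)` would make φ odd and a
-- column `(0 , 1)` would make ε positive. If `c > 0`, exchanging them changes φ by 2 and keeps ε.
even-prefix-opposite : ∀ {s s'} t → Opposite s s' → proj₂ (s ⊗ t) ≡ 0 → even (proj₁ (s ⊗ t)) ≡ true →
                       proj₂ (s' ⊗ t) ≡ 0 × even (proj₁ (s' ⊗ t)) ≡ true
even-prefix-opposite t             neutral e p = e , p
even-prefix-opposite (suc c , d)   lowHigh e p = trans (cong (d +_) (0∸n≡0 c)) e , p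
even-prefix-opposite (zero , d)    highLow e p with () ← trans (sym (+-suc d 0)) e
even-prefix-opposite (suc c , d)   highLow e p = trans (cong (d +_) (sym (0∸n≡0 c))) e , p

irrelevant : ∀ i {u} → All (λ x → x ≢ i × x ≢ suc i) u → signature i u ≡ (0 , 0)
irrelevant i []             = refl
irrelevant i {_ ∷ u} ((p , q) ∷ ps) = trans (signature-∷ (other p q) u) (irrelevant i ps)

All-reverse : ∀ {Q : ℕ → Set} {xs} → All Q xs → All Q (reverse xs)
All-reverse p = All.tabulate (λ m → All.lookup p (reverse⁻ m))

irrelevant-++ : ∀ i {u} v → All (λ x → x ≢ i × x ≢ suc i) u → φʷ i (u ++ v) ≡ φʷ i v
irrelevant-++ i {u} v p = cong proj₁ (trans (signature-++ i u v) (cong (_⊗ signature i v) (irrelevant i p)))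

complement-cong : ∀ (C C' : List ℕ) {xs} → All (λ x → (x ∈ C → x ∈ C') × (x ∈ C' → x ∈ C)) xs →
                  filter (λ x → ¬? (x ∈? C)) xs ≡ filter (λ x → ¬? (x ∈? C')) xs
complement-cong C C' []                  = refl
complement-cong C C' {x ∷ xs} ((f , g) ∷ p) with x ∈? C | x ∈? C'
... | yes _ | yes _ = complement-cong C C' p
... | yes m | no h  = ⊥-elim (h (f m))
... | no h  | yes m = ⊥-elim (h (g m))
... | no _  | no _  = cong (x ∷_) (complement-cong C C' p)

-- The interval 1, …, n is cut into the letters below i, the letters i and i+1, and
-- the letters above i+1; only the middle part tells the two complements apart.
complement-shift : ∀ {n i} a b → 1 ≤ i → i < n → Linked _<_ (a ++ i ∷ b) → Linked _<_ (a ++ suc i ∷ b) →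
                   ∃[ p ] ∃[ q ] complement n (a ++ i ∷ b) ≡ p ++ suc i ∷ q ×
                                 complement n (a ++ suc i ∷ b) ≡ p ++ i ∷ q ×
                                 All (λ x → x ≢ i × x ≢ suc i) p × All (λ x → x ≢ i × x ≢ suc i) q
complement-shift {n} {suc j} a b _ i<n l l' = go (cut (∈-applyUpTo⁺ suc (<-trans (n<1+n j) i<n)) (∈-applyUpTo⁺ suc i<n))
  where
  i = suc j
  C  = a ++ i ∷ b
  C' = a ++ suc i ∷ b
  out  = λ x → ¬? (x ∈? C)
  out' = λ x → ¬? (x ∈? C')
  Cut : List ℕ → Set
  Cut xs = ∃[ p ] ∃[ q ] xs ≡ p ++ i ∷ suc i ∷ q
  next : ∀ {q} → Linked _<_ (i ∷ q) → suc i ∈ q → ∃[ q' ] q ≡ suc i ∷ q'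
  next l       (here refl) = _ , refl
  next (k ∷ l) (there m)   = ⊥-elim (<⇒≱ (linked-< l m) k)
  suffix : ∀ p {q} → Linked _<_ (p ++ q) → Linked _<_ q
  suffix []      l = l
  suffix (_ ∷ p) l = suffix p (Linked.tail l)
  cut : i ∈ applyUpTo suc n → suc i ∈ applyUpTo suc n → Cut (applyUpTo suc n)
  cut m m' with p , q , e ← ∈-∃++ m with ∈-++⁻ p (subst (suc i ∈_) e m')
  ... | inj₁ k = ⊥-elim (<-asym (n<1+n i) (above-< p (subst (Linked _<_) e (interval-strict n)) k))
  ... | inj₂ (here f) = ⊥-elim (1+n≢n f)
  ... | inj₂ (there k) with q' , refl ← next (suffix p (subst (Linked _<_) e (interval-strict n))) k = p , q' , e
  same : ∀ {x} → x ≢ i → x ≢ suc i → (x ∈ C → x ∈ C') × (x ∈ C' → x ∈ C)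
  same f g = move f , move g
    where
    move : ∀ {x y z} → x ≢ y → x ∈ a ++ y ∷ b → x ∈ a ++ z ∷ b
    move f m with ∈-++⁻ a m
    ... | inj₁ k         = ∈-++⁺ˡ k
    ... | inj₂ (here e)  = ⊥-elim (f e)
    ... | inj₂ (there k) = ∈-++⁺ʳ a (there k)
  si∉C : suc i ∉ C
  si∉C m with ∈-++⁻ a m
  ... | inj₁ k         = <-asym (n<1+n i) (above-< a l k)
  ... | inj₂ (here e)  = 1+n≢n e
  ... | inj₂ (there k) = <-irrefl refl (below-> a l' k)
  i∉C' : i ∉ C'
  i∉C' m with ∈-++⁻ a m
  ... | inj₁ k         = <-irrefl refl (above-< a l k)
  ... | inj₂ (here e)  = 1+n≢n (sym e)
  ... | inj₂ (there k) = <-irrefl refl (below-> a l k)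
  go : Cut (applyUpTo suc n) → _
  go (p , q , e) = filter out p , filter out q ,
    trans (cong (filter out) e) (trans (filter-++ out p _) (cong (filter out p ++_)
      (trans (filter-reject out (λ f → f (∈-++⁺ʳ a (here refl)))) (filter-accept out si∉C)))) ,
    trans (cong (filter out') e) (trans (filter-++ out' p _) (cong₂ _++_ (sym (complement-cong C C' (All.map (λ (f , g) → same f g) p≢)))
      (trans (filter-accept out' i∉C') (cong (i ∷_) (trans (filter-reject out' (λ f → f (∈-++⁺ʳ a (here refl))))
        (sym (complement-cong C C' (All.map (λ (f , g) → same f g) q≢)))))))) ,
    Allₚ.filter⁺ out p≢ , Allₚ.filter⁺ out q≢
    where
    L = subst (Linked _<_) e (interval-strict n)
    p≢ : All (λ x → x ≢ i × x ≢ suc i) p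
    p≢ = All.tabulate λ m → let k = above-< p L m in <⇒≢ k , <⇒≢ (m<n⇒m<1+n k)
    q≢ : All (λ x → x ≢ i × x ≢ suc i) q
    q≢ = All.tabulate λ m →
      let k = below-> (p ++ i ∷ []) (subst (Linked _<_) (sym (++-assoc p (i ∷ []) (suc i ∷ q))) L) m
      in >⇒≢ (<-trans (n<1+n i) k) , >⇒≢ k

++-injective : ∀ (u u' : Word) {v v'} → length u ≡ length u' → u ++ v ≡ u' ++ v' → u ≡ u' × v ≡ v'
++-injective u u' {v} {v'} e f =
  trans (sym (take-++ u e)) (trans (cong (take (length u')) f) (take-++ u' refl)) ,
  trans (sym (drop-++ u e)) (trans (cong (drop (length u')) f) (drop-++ u' refl))

-- If the changed letter lies behind the column, then `C = C'` and `even-prefix-opposite` keeps the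
-- position and the direction. If it lies in the column, the complements contain `i+1` and `i` in
-- the opposite roles, so the direction is reversed.
paired-complement : ∀ {n i C C' v v'} → 1 ≤ i → i < n → Linked _<_ C → Linked _<_ C' → length C ≡ length C' →
  Paired i (reverse C ++ v) (reverse C' ++ v') →
  Paired i (reverse (complement n C) ++ v) (reverse (complement n C') ++ v') ⊎
  Paired i (reverse (complement n C') ++ v') (reverse (complement n C) ++ v)
paired-complement {n} {i} {C} {C'} {v} {v'} 1≤i i<n l l' len (paired (split u s o w e f) p)
  with split-++ (reverse C) v u o
... | inj₂ (t , refl , refl) with ++-injective (reverse C') (reverse C)
        (trans (length-reverse C') (trans (sym len) (sym (length-reverse C)))) (trans w (++-assoc (reverse C) t (suc i ∷ s)))
...   | g , refl with refl ← reverse-injective {x = C'} {y = C} g =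
  inj₁ (paired (split (reverse K ++ t) s (sym (++-assoc (reverse K) t (i ∷ s))) (sym (++-assoc (reverse K) t (suc i ∷ s))) e
    (trans ε-K (proj₁ even-K)))
    (trans φ-K (proj₂ even-K)))
  where
  K = complement n C
  even-K = even-prefix-opposite (signature i t) (opposite 1≤i i<n l)
    (trans (sym (cong proj₂ (signature-++ i (reverse C) t))) f)
    (trans (sym (cong (even ∘ proj₁) (signature-++ i (reverse C) t))) p)
  ε-K = cong proj₂ (signature-++ i (reverse K) t)
  φ-K = cong (even ∘ proj₁) (signature-++ i (reverse K) t)
paired-complement {n} {i} {C} {C'} {v} {v'} 1≤i i<n l l' len (paired (split u s o w e f) p)
    | inj₁ (t , g , refl) with ++-injective (reverse C') (u ++ suc i ∷ t)
        (trans (length-reverse C') (trans (sym len) (trans (sym (length-reverse C)) (trans (cong length g)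
          (trans (length-++ u) (sym (length-++ u)))))))
        (trans w (sym (++-assoc u (suc i ∷ t) v)))
... | g' , refl = shifted (trans (sym (reverse-involutive C)) (trans (cong reverse g) (reverse-mid u i t)))
                          (trans (sym (reverse-involutive C')) (trans (cong reverse g') (reverse-mid u (suc i) t)))
  where
  shifted : C ≡ reverse t ++ i ∷ reverse u → C' ≡ reverse t ++ suc i ∷ reverse u → _
  shifted refl refl with y , z , k , k' , y≢ , z≢ ← complement-shift (reverse t) (reverse u) 1≤i i<n l l' =
    -- The part `z` read before the changed letter contains neither `i` nor `i+1`, so its signature
    -- is `(0 , 0)` and its φ is even.
    inj₂ (paired (split (reverse z) (reverse y ++ v)
      (trans (cong (λ c → reverse c ++ v) k') (trans (cong (_++ v) (reverse-mid y i z)) (++-assoc (reverse z) (i ∷ reverse y) v)))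
      (trans (cong (λ c → reverse c ++ v) k) (trans (cong (_++ v) (reverse-mid y (suc i) z)) (++-assoc (reverse z) (suc i ∷ reverse y) v)))
      (trans (irrelevant-++ i v (All-reverse y≢)) φv)
      (cong proj₂ (irrelevant i (All-reverse z≢))))
      (cong (even ∘ proj₁) (irrelevant i (All-reverse z≢))))
    where
    t≢ : All (λ x → x ≢ i × x ≢ suc i) t
    t≢ = All.tabulate λ m → let k = above-< (reverse t) l (reverse⁺ m) in <⇒≢ k , <⇒≢ (m<n⇒m<1+n k)
    -- `t` consists of the entries above `i` in `C`, all smaller than `i`, so φ = 0 passes from
    -- `t ++ v` to `v`.
    φv : φʷ i v ≡ 0
    φv = trans (sym (irrelevant-++ i v t≢)) e

-- The map K₁
CR-first : ∀ T → CR T ≡ reverse (column 0 T) ++ reading (drop 1 (columns T))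
CR-first T with columns T
... | []    = refl
... | _ ∷ _ = refl

P-CR-rows : ∀ {n μ} (T : SST n μ) → P (CR (rows T)) ≡ rows T
P-CR-rows T = P-CR (nonempty-rows T) (rows-weak (semistandard T)) (columns-strict (semistandard T))

CR-B̃ : ∀ {n μ} i (T : SST n μ) → Maybe.map (CR ∘ rows) (B̃ i T) ≡ B̃ʷ (value i) (CR (rows T))
CR-B̃ i T with even (φ i T)
... | true  = CR-Ẽ i T
... | false = CR-F̃ i T

-- As `P` recovers a tableau from its column reading, the operator on tableaux can be computed on
-- words.
rows-B̃ : ∀ {n μ} i (T : SST n μ) → Maybe.map rows (B̃ i T) ≡ Maybe.map P (B̃ʷ (value i) (CR (rows T)))
rows-B̃ i T = trans (go (B̃ i T)) (cong (Maybe.map P) (CR-B̃ i T))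
  where
  go : ∀ m → Maybe.map rows m ≡ Maybe.map P (Maybe.map (CR ∘ rows) m)
  go nothing   = refl
  go (just T') = cong just (sym (P-CR-rows T'))

degree-K₁ʷ : ∀ {n μ} i (T : SST n μ) →
             degree (signature (value i) (K₁ʷ n (rows T))) ≡ degree (signature (value i) (CR (rows T)))
degree-K₁ʷ {n} i T = begin
  degree (signature (value i) (reverse K ++ v))   ≡⟨ cong degree (signature-++ (value i) (reverse K) v) ⟩
  degree (signature (value i) (reverse K) ⊗ t)    ≡⟨ degree-opposite t (opposite {n} (1≤value i) (value<n i) l) ⟨
  degree (signature (value i) (reverse C) ⊗ t)    ≡⟨ cong degree (signature-++ (value i) (reverse C) v) ⟨
  degree (signature (value i) (reverse C ++ v))   ≡⟨ cong (degree ∘ signature (value i)) (CR-first (rows T)) ⟨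
  degree (signature (value i) (CR (rows T)))      ∎
  where
  open ≡-Reasoning
  C = column 0 (rows T)
  K = complement n C
  v = reading (drop 1 (columns (rows T)))
  t = signature (value i) v
  l = column-strict 0 (semistandard T)

first-length : ∀ {T T'} → map length T ≡ map length T' → length (column 0 T) ≡ length (column 0 T')
first-length {T} {T'} e = go (columns T) (columns T') (transpose-lengths T T' e)
  where
  go : ∀ cs cs' → map length cs ≡ map length cs' →
       length (fromMaybe [] (head cs)) ≡ length (fromMaybe [] (head cs'))
  go []       []       _ = refl
  go (_ ∷ _)  (_ ∷ _)  e = ∷-injectiveˡ e

-- Complementing may exchange raising and lowering, but `B̃ʷ` joins the two words of a pair either
-- way. Both tableaux have the same shape, so their first columns have the same length.
B̃ʷ-K₁ʷ : ∀ {n μ} i (T T' : SST n μ) → B̃ʷ (value i) (CR (rows T)) ≡ just (CR (rows T')) →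
         B̃ʷ (value i) (K₁ʷ n (rows T)) ≡ just (K₁ʷ n (rows T'))
B̃ʷ-K₁ʷ {n} i T T' e =
  [ [ B̃ʷ-raise , B̃ʷ-lower ]′ ∘ swap T T' same
  , [ B̃ʷ-lower , B̃ʷ-raise ]′ ∘ swap T' T (sym same) ]′ (B̃ʷ⇒paired (value i) (CR (rows T)) e)
  where
  same : length (column 0 (rows T)) ≡ length (column 0 (rows T'))
  same = first-length (trans (shape T) (sym (shape T')))
  swap : ∀ T T' → length (column 0 (rows T)) ≡ length (column 0 (rows T')) →
         Paired (value i) (CR (rows T)) (CR (rows T')) →
         Paired (value i) (K₁ʷ n (rows T)) (K₁ʷ n (rows T')) ⊎ Paired (value i) (K₁ʷ n (rows T')) (K₁ʷ n (rows T))
  swap T T' e p = paired-complement {n} (1≤value i) (value<n i)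
    (column-strict 0 (semistandard T)) (column-strict 0 (semistandard T')) e
    (subst₂ (Paired (value i)) (CR-first (rows T)) (CR-first (rows T')) p)

-- The left side is the rows of `K₁` after `B̃`. On the right, `CR-P` allows `B̃` to be evaluated on
-- `K₁ʷ` instead of the column reading of `K₁ T`, since both give the same `P`-symbol.
K₁-B̃ : ∀ {n} i (T : SST⊔ n) →
       Maybe.map (P ∘ K₁ʷ n ∘ rows) (B̃ i (proj₂ T)) ≡ Maybe.map rows (B̃ i (proj₂ (K₁ T)))
K₁-B̃ {n} i (μ , T) = trans (go (B̃ i T) (CR-B̃ i T))
  (sym (trans (rows-B̃ i (proj₂ (K₁ (μ , T)))) (P-B̃ʷ-≈ (value i) (CR-P (K₁ʷ n (rows T))))))
  where
  go : ∀ m → Maybe.map (CR ∘ rows) m ≡ B̃ʷ (value i) (CR (rows T)) →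
       Maybe.map (P ∘ K₁ʷ n ∘ rows) m ≡ Maybe.map P (B̃ʷ (value i) (K₁ʷ n (rows T)))
  go (just T') e = cong (Maybe.map P) (sym (B̃ʷ-K₁ʷ i T T' (sym e)))
  go nothing   e = cong (Maybe.map P) (sym (B̃ʷ-nothing⁺ (value i) (K₁ʷ n (rows T))
    (trans (degree-K₁ʷ i T) (B̃ʷ-nothing⁻ (value i) (CR (rows T)) (sym e)))))

deg-K₁ : ∀ {n} i (T : SST⊔ n) → deg i (proj₂ (K₁ T)) ≡ deg i (proj₂ T)
deg-K₁ {n} i (μ , T) = trans (cong degree (signature-≈ (value i) (CR-P (K₁ʷ n (rows T))))) (degree-K₁ʷ i T)

deg-iterate : ∀ {n} i (T : SST⊔ n) r → deg i (proj₂ (iterate K₁ T r)) ≡ deg i (proj₂ T)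
deg-iterate i T zero    = refl
deg-iterate i T (suc r) = trans (deg-iterate i (K₁ T) r) (deg-K₁ i T)

-- AI-tableaux along the orbits of `K₁`

-- Replacing the first column of an AI-tableau by its complement gives columns of a
-- semistandard tableau, which P leaves unchanged.
AI⇒d₁-K₁ : ∀ {n} → 3 ≤ n → (T : SST⊔ n) → IsAI⊔ T →
             d₁ (K₁ T) ≡ length (complement n (column 0 (rows (proj₂ T))))
AI⇒d₁-K₁ {n} 3≤n (_ , T) (d≤m , u) = cong length (begin
  column 0 (P (reading (K ∷ Cs)))                            ≡⟨ cong (column 0 ∘ P ∘ reading) (sym involutive) ⟩
  column 0 (P (CR (transpose (K ∷ Cs))))                     ≡⟨ cong (column 0) (P-CR (transpose-nonempty (K ∷ Cs)) (rows-weak s) (columns-strict s)) ⟩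
  column 0 (transpose (K ∷ Cs))                              ≡⟨ cong (fromMaybe [] ∘ head) involutive ⟩
  K                                                          ∎)
  where
  open ≡-Reasoning
  C  = column 0 (rows T)
  K  = complement n C
  Cs = drop 1 (columns (rows T))
  g  = good-columns (semistandard T)
  weak-drop : ∀ {cs} → Linked (Under _≤_) cs → Under _≤_ K (fromMaybe [] (head (drop 1 cs))) →
              Linked (Under _≤_) (K ∷ drop 1 cs)
  weak-drop []      u = [-]
  weak-drop [-]     u = [-]
  weak-drop (_ ∷ l) u = u ∷ l
  g' : GoodColumns n (K ∷ Cs)
  g' = record
    { bounded = complement-bounded n C ∷ Allₚ.drop⁺ 1 (GoodColumns.bounded g)
    ; strict  = complement-strict n C ∷ Allₚ.drop⁺ 1 (GoodColumns.strict g)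
    ; weak    = weak-drop (GoodColumns.weak g) u
    }
  s = good-rows g'
  -- The hypothesis `3 ≤ n` enters here: the complement has at least `⌊ n /2⌋` entries and so is not
  -- empty, whereas `transpose` would lose an empty column.
  m>0 : 0 < ⌊ n /2⌋
  m>0 = ≤-trans (s≤s z≤n) (⌊n/2⌋-mono 3≤n)
  K-nonempty : 0 < length K
  K-nonempty = ≤-trans m>0 (short-complement d≤m
    (complement-length (column-strict 0 (semistandard T)) (column-bounded 0 (semistandard T))))
  involutive : columns (transpose (K ∷ Cs)) ≡ K ∷ Cs
  involutive = transpose-involutive (K-nonempty ∷ Allₚ.drop⁺ 1 (transpose-nonempty (rows T))) (GoodColumns.weak g')

-- The first column of `K₁ T` is exactly as long as the complement of that of `T`, while
-- `short-grows` would make it strictly longer for `T'`; yet the hypotheses identify both lengths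
-- for `T` and `T'`.
AI-transfer : ∀ {n} → 3 ≤ n → (T T' : SST⊔ n) → d₁ T ≡ d₁ T' → d₁ (K₁ T) ≡ d₁ (K₁ T') → IsAI⊔ T → IsAI⊔ T'
AI-transfer {n} 3≤n T T' e e' g with IsAI? n (rows (proj₂ T'))
... | yes g' = g'
... | no f   = ⊥-elim (<-irrefl (trans (sym c≡c') (trans (sym (AI⇒d₁-K₁ 3≤n T g)) e'))
                 (short-grows T' (subst (_≤ ⌊ n /2⌋) e (proj₁ g)) f))
  where
  size-complement : (T : SST⊔ n) → d₁ T + length (complement n (column 0 (rows (proj₂ T)))) ≡ n
  size-complement (_ , T) = complement-length (column-strict 0 (semistandard T)) (column-bounded 0 (semistandard T))
  c≡c' : length (complement n (column 0 (rows (proj₂ T)))) ≡ length (complement n (column 0 (rows (proj₂ T'))))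
  c≡c' = +-cancelˡ-≡ (d₁ T) _ _ (trans (size-complement T)
    (trans (sym (size-complement T')) (cong (_+ length (complement n (column 0 (rows (proj₂ T'))))) (sym e))))

-- `T'` carries its own partition and only rows are compared, so `K₁` can be applied to both
-- tableaux without transporting along an equality of shapes.
Moved : ∀ {n} → Index n → SST⊔ n → SST⊔ n → Set
Moved i T T' = Maybe.map rows (B̃ i (proj₂ T)) ≡ just (rows (proj₂ T'))

Moved-K₁ : ∀ {n i} (T T' : SST⊔ n) → Moved i T T' → Moved i (K₁ T) (K₁ T')
Moved-K₁ {n} {i} T T' e = trans (sym (K₁-B̃ i T)) (go (B̃ i (proj₂ T)) e)
  where
  go : ∀ m → Maybe.map rows m ≡ just (rows (proj₂ T')) → Maybe.map (P ∘ K₁ʷ n ∘ rows) m ≡ just (rows (proj₂ (K₁ T')))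
  go (just T'') e = cong (Maybe.map (P ∘ K₁ʷ n)) e

Moved-iterate : ∀ {n i} r (T T' : SST⊔ n) → Moved i T T' → Moved i (iterate K₁ T r) (iterate K₁ T' r)
Moved-iterate zero    T T' e = e
Moved-iterate (suc r) T T' e = Moved-iterate r (K₁ T) (K₁ T') (Moved-K₁ T T' e)

Moved-d₁ : ∀ {n i} (T T' : SST⊔ n) → Moved i T T' → d₁ T ≡ d₁ T'
Moved-d₁ {i = i} (_ , T) T' = go (B̃ i T)
  where
  go : ∀ m → Maybe.map rows m ≡ just (rows (proj₂ T')) → length (column 0 (rows T)) ≡ d₁ T'
  go (just T'') e = trans (first-length (trans (shape T) (sym (shape T''))))
                          (cong (length ∘ column 0 ∘ fromMaybe []) e)

Moved-AI : ∀ {n i} → 3 ≤ n → (T T' : SST⊔ n) → Moved i T T' → (IsAI⊔ T → IsAI⊔ T') × (IsAI⊔ T' → IsAI⊔ T)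
Moved-AI 3≤n T T' e = AI-transfer 3≤n T T' d dK , AI-transfer 3≤n T' T (sym d) (sym dK)
  where
  d  = Moved-d₁ T T' e
  dK = Moved-d₁ (K₁ T) (K₁ T') (Moved-K₁ T T' e)

-- At every stage the two orbits agree on being an AI-tableau, so by minimality neither exponent can
-- be smaller than the other.
reaches-Moved : ∀ {n i} → 3 ≤ n → (T T' : SST⊔ n) → Moved i T T' → proj₁ (reaches T) ≡ proj₁ (reaches T')
reaches-Moved 3≤n T T' e = go (reaches T) (reaches T')
  where
  transfer : ∀ r → _
  transfer r = Moved-AI 3≤n (iterate K₁ T r) (iterate K₁ T' r) (Moved-iterate r T T' e)
  go : (p : Reaches T) (p' : Reaches T') → proj₁ p ≡ proj₁ p'
  go (r , g , h) (r' , g' , h') with <-cmp r r'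
  ... | tri< l _ _ = ⊥-elim (h' r l (proj₁ (transfer r) g))
  ... | tri≈ _ q _ = q
  ... | tri> _ _ l = ⊥-elim (h r' l (proj₂ (transfer r') g'))

B̃-nothing-iterate : ∀ {n i} r (T : SST⊔ n) → Maybe.map rows (B̃ i (proj₂ T)) ≡ nothing →
                    Maybe.map rows (B̃ i (proj₂ (iterate K₁ T r))) ≡ nothing
B̃-nothing-iterate zero    T e = e
B̃-nothing-iterate {n} {i} (suc r) T e = B̃-nothing-iterate r (K₁ T) (trans (sym (K₁-B̃ i T)) (go (B̃ i (proj₂ T)) e))
  where
  go : ∀ m → Maybe.map rows m ≡ nothing → Maybe.map (P ∘ K₁ʷ n ∘ rows) m ≡ nothing
  go nothing _ = refl

Pᴬᴵ-B̃ : ∀ {n} → 3 ≤ n → ∀ i (T : SST⊔ n) →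
        Maybe.map (rows ∘ tableau ∘ proj₂ ∘ Pᴬᴵ) (B̃⊔ i T) ≡ Maybe.map rows (B̃ i (tableau (proj₂ (Pᴬᴵ T))))
Pᴬᴵ-B̃ 3≤n i (μ , T) = go (B̃ i T) refl
  where
  r = proj₁ (reaches (μ , T))
  go : ∀ m → B̃ i T ≡ m → Maybe.map (rows ∘ tableau ∘ proj₂ ∘ Pᴬᴵ) (Maybe.map (μ ,_) m) ≡
                         Maybe.map rows (B̃ i (proj₂ (iterate K₁ (μ , T) r)))
  go nothing   e = sym (B̃-nothing-iterate r (μ , T) (cong (Maybe.map rows) e))
  -- The orbits are first compared after the exponent belonging to `T`, which is then replaced by
  -- the equal exponent of `T'`.
  go (just T') e = sym (trans (Moved-iterate r (μ , T) (μ , T') moved)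
    (cong (λ s → just (rows (proj₂ (iterate K₁ (μ , T') s)))) (reaches-Moved 3≤n (μ , T) (μ , T') moved)))
    where
    moved : Moved i (μ , T) (μ , T')
    moved = cong (Maybe.map rows) e

proposition2p5p12 : (n : ℕ) → 3 ≤ n → IsMorphism {n} Pᴬᴵ
proposition2p5p12 n 3≤n = record
  { B̃-homo   = Pᴬᴵ-B̃ 3≤n
  ; deg-homo = λ i T → deg-iterate i T (proj₁ (reaches T))
  }
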